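{- Let $G(n,1/2)$ be the uniformly random graph on the vertex set $\{1,\ldots,n\}$. Suppose that both of the following conjectures are true: (Conjecture A) with probability tending to $1$ as $n\to\infty$, the random graph $G(n,1/2)$ is determined by spectrum; (Conjecture B) with probability tending to $1$ as $n\to\infty$, the characteristic polynomial of the random graph $G(n,1/2)$ is irreducible over $\mathbb{Q}$. Then, with probability tending to $1$ as $n\to\infty$, every vertex of $G(n,1/2)$ is decisive.
   Context: All graphs are finite, simple and undirected. For a graph $G$ with adjacency matrix $A$, $P_G(z)=\det(zI-A)$ is its characteristic polynomial. A graph $G$ is determined by spectrum if, for every graph $H$, $P_G=P_H$ implies $G\cong H$. A walk of length $k$ starting at a vertex $v$ in a graph $G$ is a sequence of vertices $v=v_0,v_1,\ldots,v_k$ such that every two successive vertices are adjacent; it is closed if $v_0=v_k$. Let $w_G^k(v)$ be the number of walks of length $k$ in $G$ starting at $v$, and $r_G^k(v)$ the number of closed walks of length $k$ in $G$ starting (and ending) at $v$. Put $W_G(v)=(w_G^1(v),w_G^2(v),\ldots)$ and $R_G(v)=(r_G^1(v),r_G^2(v),\ldots)$. $G_v$ denotes the graph $G$ rooted at $v$; $G_v\cong H_u$ means that there is an isomorphism from $G$ to $H$ taking $v$ to $u$. For $I\in\{W,R\}$, a vertex $v$ of a connected $n$-vertex graph $G$ is $I$-decisive if for every connected $n$-vertex graph $H$ and every $u\in V(H)$, the equality $I_G(v)=I_H(u)$ implies $G_v\cong H_u$. A vertex is decisive if it is both $W$-decisive and $R$-decisive; the notion presupposes that $G$ is connected. -}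

module Defs where

open import Algebra.Bundles.Raw using (RawRing)
import Algebra.Definitions.RawSemiring as RawSemiringDefinitions
open import Data.Bool.Base using (Bool; true; false; T; if_then_else_)
open import Data.Bool.Properties using (T?)
open import Data.Fin.Base using (Fin; zero; suc; toℕ; punchIn)
import Data.Fin.Properties as Fin
open import Data.Integer.Base using (+_)
open import Data.List.Base as List using (List; length; filter; cartesianProductWith; allFin)
open import Data.List.Relation.Unary.All using (All)
open import Data.List.Relation.Unary.AllPairs using (AllPairs)
open import Data.Nat.Base as ℕ using (ℕ; zero; suc; NonZero)
open import Data.Nat.Combinatorics using (_C_)
open import Data.Nat.Properties using (m^n≢0)
open import Data.Product.Base using (Σ-syntax; ∃-syntax; _×_)
open import Data.Rational.Base as ℚ using (ℚ; 0ℚ; 1ℚ)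
open import Data.Vec.Base as Vec using (Vec; []; _∷_)
open import Data.Vec.Relation.Unary.Linked using (Linked; linked?)
open import Function.Bundles using (_↔_; Inverse)
open import Level using (0ℓ)
open import Relation.Binary.Construct.Closure.ReflexiveTransitive using (Star)
open import Relation.Binary.PropositionalEquality using (_≡_; _≗_)
open import Relation.Nullary using (¬_; Dec; does)
open import Relation.Nullary.Decidable using (_×-dec_)

------------------------------------------------------------------------
-- Graphs

record Graph (n : ℕ) : Set where
  field
    adj         : Fin n → Fin n → Bool
    symmetric   : ∀ i j → adj i j ≡ adj j i
    irreflexive : ∀ i → adj i i ≡ false

open Graph public

Adj : ∀ {n} → Graph n → Fin n → Fin n → Set
Adj G i j = T (adj G i j)

-- Equality of labelled graphs.  Propositional equality of the records
-- would require function extensionality.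

infix 4 _≐_ _≅_

_≐_ : ∀ {n} → Graph n → Graph n → Set
G ≐ H = ∀ i j → adj G i j ≡ adj H i j

record _≅_ {m n : ℕ} (G : Graph m) (H : Graph n) : Set where
  field
    bijection : Fin m ↔ Fin n
    preserves : ∀ i j →
      adj H (Inverse.to bijection i) (Inverse.to bijection j) ≡ adj G i j

  map : Fin m → Fin n
  map = Inverse.to bijection

RootedIso : ∀ {m n} → Graph m → Fin m → Graph n → Fin n → Set
RootedIso G v H u = Σ[ φ ∈ G ≅ H ] _≅_.map φ v ≡ u

Connected : ∀ {n} → Graph n → Set
Connected G = ∀ u v → Star (Adj G) u v

------------------------------------------------------------------------
-- Univariate polynomials over ℚ

-- A list of coefficients, constant term first.  Trailing zeros are
-- allowed, so equality of polynomials is _≈ₚ_ and not _≡_.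

Poly : Set
Poly = List ℚ

coeff : Poly → ℕ → ℚ
coeff List.[]       k       = 0ℚ
coeff (a List.∷ p)  zero    = a
coeff (a List.∷ p)  (suc k) = coeff p k

infix  4 _≈ₚ_
infixl 6 _+ₚ_
infixl 7 _*ₚ_

_≈ₚ_ : Poly → Poly → Set
p ≈ₚ q = ∀ k → coeff p k ≡ coeff q k

_+ₚ_ : Poly → Poly → Poly
List.[]      +ₚ q            = q
(a List.∷ p) +ₚ List.[]      = a List.∷ p
(a List.∷ p) +ₚ (b List.∷ q) = (a ℚ.+ b) List.∷ (p +ₚ q)

_*ₚ_ : Poly → Poly → Poly
List.[]      *ₚ q = List.[]
(a List.∷ p) *ₚ q = List.map (a ℚ.*_) q +ₚ (0ℚ List.∷ (p *ₚ q))

constant : ℚ → Poly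
constant a = a List.∷ List.[]

indeterminate : Poly
indeterminate = 0ℚ List.∷ 1ℚ List.∷ List.[]

ℚ[z] : RawRing 0ℓ 0ℓ
ℚ[z] = record
  { Carrier = Poly
  ; _≈_     = _≈ₚ_
  ; _+_     = _+ₚ_
  ; _*_     = _*ₚ_
  ; -_      = List.map (ℚ.-_)
  ; 0#      = List.[]
  ; 1#      = constant 1ℚ
  }

-- The zero polynomial is not irreducible in this sense: 0 = 0 · 0, and
-- 0 does not divide 1.

IrreducibleOverℚ : Poly → Set
IrreducibleOverℚ =
  RawSemiringDefinitions.Irreducible (RawRing.rawSemiring ℚ[z])

------------------------------------------------------------------------
-- Characteristic polynomial

module _ {c ℓ} (R : RawRing c ℓ) where
  open RawRing R
  open RawSemiringDefinitions rawSemiring using (sum; _^_)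

  -- Laplace expansion along the first row.

  det : ∀ n → (Fin n → Fin n → Carrier) → Carrier
  det zero    M = 1#
  det (suc n) M = sum λ j →
    (- 1#) ^ toℕ j * (M zero j * det n (λ i k → M (suc i) (punchIn j k)))

adjacencyMatrix : ∀ {n} → Graph n → Fin n → Fin n → ℚ
adjacencyMatrix G i j = if adj G i j then 1ℚ else 0ℚ

zI-_ : ∀ {n} → (Fin n → Fin n → ℚ) → Fin n → Fin n → Poly
(zI- A) i j = (if does (i Fin.≟ j) then indeterminate else 0#)
              + (- constant (A i j))
  where open RawRing ℚ[z]

charPoly : ∀ {n} → Graph n → Poly
charPoly {n} G = det ℚ[z] n (zI- adjacencyMatrix G)

DeterminedBySpectrum : ∀ {n} → Graph n → Set
DeterminedBySpectrum G =
  ∀ {m} (H : Graph m) → charPoly G ≈ₚ charPoly H → G ≅ H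

IrreducibleCharPoly : ∀ {n} → Graph n → Set
IrreducibleCharPoly G = IrreducibleOverℚ (charPoly G)

------------------------------------------------------------------------
-- Walks

allVecs : ∀ n l → List (Vec (Fin n) l)
allVecs n zero    = [] List.∷ List.[]
allVecs n (suc l) = cartesianProductWith _∷_ (allFin n) (allVecs n l)

-- A walk of length k has k + 1 vertices.

module _ {n : ℕ} (G : Graph n) (v : Fin n) {k : ℕ} where

  IsWalkFrom : Vec (Fin n) (suc k) → Set
  IsWalkFrom vs = Vec.head vs ≡ v × Linked (Adj G) vs

  IsClosedWalkFrom : Vec (Fin n) (suc k) → Set
  IsClosedWalkFrom vs = IsWalkFrom vs × Vec.head vs ≡ Vec.last vs

  isWalkFrom? : ∀ vs → Dec (IsWalkFrom vs)
  isWalkFrom? vs =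
    (Vec.head vs Fin.≟ v) ×-dec linked? (λ i j → T? (adj G i j)) vs

  isClosedWalkFrom? : ∀ vs → Dec (IsClosedWalkFrom vs)
  isClosedWalkFrom? vs =
    isWalkFrom? vs ×-dec (Vec.head vs Fin.≟ Vec.last vs)

walkCount : ∀ {n} → Graph n → Fin n → ℕ → ℕ
walkCount {n} G v k = length (filter (isWalkFrom? G v) (allVecs n (suc k)))

closedWalkCount : ∀ {n} → Graph n → Fin n → ℕ → ℕ
closedWalkCount {n} G v k =
  length (filter (isClosedWalkFrom? G v) (allVecs n (suc k)))

-- The sequences start with walks of length 1: the term at index i counts
-- walks of length i + 1.

W R : ∀ {n} → Graph n → Fin n → ℕ → ℕ
W G v i = walkCount G v (suc i)
R G v i = closedWalkCount G v (suc i)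

------------------------------------------------------------------------
-- Decisive vertices

IsDecisiveFor : (∀ {n} → Graph n → Fin n → ℕ → ℕ) →
                ∀ {n} → Graph n → Fin n → Set
IsDecisiveFor I {n} G v =
  Connected G ×
  ((H : Graph n) → Connected H → (u : Fin n) →
   I G v ≗ I H u → RootedIso G v H u)

Decisive : ∀ {n} → Graph n → Fin n → Set
Decisive G v = IsDecisiveFor W G v × IsDecisiveFor R G v

------------------------------------------------------------------------
-- The uniformly random graph on n labelled vertices

numberOfGraphs : ℕ → ℕ
numberOfGraphs n = 2 ℕ.^ (n C 2)

numberOfGraphs-nonZero : ∀ n → NonZero (numberOfGraphs n)
numberOfGraphs-nonZero n = m^n≢0 2 (n C 2)

-- "The probability of E is at least p": some pairwise distinct graphs,
-- all having E, make up at least the fraction p of all graphs.  Listing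
-- graphs with the property, rather than filtering all graphs by it, lets
-- E be a property that is not accompanied by a decision procedure.

ProbabilityAtLeast : ∀ n → ℚ → (Graph n → Set) → Set
ProbabilityAtLeast n p E =
  ∃[ Gs ] AllPairs (λ G H → ¬ (G ≐ H)) Gs
        × All E Gs
        × p ℚ.≤ ((+ length Gs) ℚ./ numberOfGraphs n)
                  {{numberOfGraphs-nonZero n}}

-- "With probability tending to 1 as n → ∞".

AsymptoticallyAlmostSurely : (∀ {n} → Graph n → Set) → Set
AsymptoticallyAlmostSurely E =
  ∀ ε → 0ℚ ℚ.< ε →
  ∃[ N ] (∀ n → N ℕ.≤ n → ProbabilityAtLeast n (1ℚ ℚ.- ε) E)

{-# OPTIONS --safe #-}

-- Let A be the adjacency matrix of G, with irreducible characteristic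
-- polynomial P of degree n.  By Cayley–Hamilton ℚⁿ is a one-dimensional
-- vector space over the field ℚ[z]/(P), so every nonzero y is a cyclic
-- vector, and x = 0 as soon as x ⊥ Aᵏy for all k.  Cyclicity of e_v makes
-- G connected.
--
-- Both walk sequences have the form ⟨x, Aᵏy⟩, with x = e_v and y = 𝟏 or
-- y = e_v.  If ⟨x, Aᵏy⟩ = ⟨x′, Bᵏy′⟩ for all k, then x is orthogonal to
-- the A-orbit of P_B(A)y; hence P_B(A)y = 0, and P_B = P_A because both
-- are monic of degree n.  So G ≅ H by determination by spectrum, and it
-- remains to separate vertices u, v inside G: e_v − e_u is orthogonal to
-- the orbit of 𝟏 in the first case, and, A being symmetric, to the orbit
-- of e_v + e_u in the second.

module Submission where

open import Algebra.Bundles using (CommutativeRing; Semiring)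
open import Algebra.Definitions.RawMagma using (_,_)
import Algebra.Definitions.RawSemiring as RawSemiringDefinitions
import Algebra.Properties.Monoid.Mult as Mult
import Algebra.Properties.Ring as RingProperties
import Algebra.Properties.Semiring.Sum as SemiringSum
import Algebra.Solver.Ring.NaturalCoefficients.Default as NaturalCoefficients
open import Algebra.Structures using (IsCommutativeRing)
open import Data.Bool.Base using (Bool; true; false; if_then_else_)
open import Data.Bool.Properties using (T?)
import Data.Bool.Properties as Bool
open import Data.Fin.Base as Fin using (Fin; zero; suc; toℕ; punchIn; combine; cast)
import Data.Fin.Properties as Fin
open import Data.Integer.Base as ℤ using (+_)
import Data.Integer.Properties as ℤ
import Data.Integer.Solver as ℤ
open import Data.List.Base as List
  using (List; []; _∷_; _++_; length; filter; lookup; cartesianProductWith)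
open import Data.List.Membership.Propositional.Properties using (∈-lookup)
import Data.List.Properties as List
open import Data.List.Relation.Unary.All as All using (All; []; _∷_; universal)
import Data.List.Relation.Unary.All.Properties as All
open import Data.List.Relation.Unary.AllPairs using (AllPairs; []; _∷_)
import Data.List.Relation.Unary.AllPairs.Properties as AllPairs
open import Data.List.Relation.Unary.Any using (Any; any?)
open import Data.Nat.Base as ℕ using (ℕ; zero; suc; NonZero; s≤s; z≤n)
import Data.Nat.Combinatorics as ℕ using (_C_; nC1≡n; nCk+nC[k+1]≡[n+1]C[k+1])
import Data.Nat.Properties as ℕ
open import Data.Product.Base using (_,_; _×_; Σ-syntax; ∃-syntax; proj₁; proj₂)
open import Data.Rational.Base as ℚ using (ℚ; 0ℚ; 1ℚ)
import Data.Rational.Properties as ℚ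
open import Data.Rational.Solver using (module +-*-Solver)
import Data.Rational.Unnormalised.Base as ℚᵘ
import Data.Rational.Unnormalised.Properties as ℚᵘ
open import Data.Sum.Base using (_⊎_; inj₁; inj₂; [_,_]′)
open import Data.Unit.Base using (tt)
open import Data.Vec.Base as Vec using (Vec; []; _∷_)
open import Data.Vec.Functional using (Vector; updateAt; insertAt)
import Data.Vec.Functional.Properties as Vector
open import Data.Vec.Relation.Unary.Linked as Linked using (Linked; _∷_; linked?)
open import Function.Base using (_∘_; const; id)
open import Function.Bundles using (Inverse)
open import Level using (0ℓ)
open import Relation.Binary.Construct.Closure.ReflexiveTransitive using (Star; _◅_; _◅◅_)
open import Relation.Binary.Definitions using (tri<; tri≈; tri>)
open import Relation.Binary.PropositionalEquality as ≡
  using (_≡_; _≢_; _≗_; module ≡-Reasoning)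
import Relation.Binary.Reasoning.Setoid as SetoidReasoning
open import Relation.Nullary using (¬_; ¬?; Dec; yes; no; contradiction; does)
open import Relation.Nullary.Decidable using (_×-dec_; decidable-stable)
open import Relation.Unary using (Pred; Decidable)

open import Defs

-- Determinants

-- The field ℚ[z]/(P) is never built. Euclidean descent below P shows that no nonzero polynomial of
-- degree less than n kills a nonzero y. Since n + 1 vectors in ℚⁿ are dependent, every x then
-- satisfies c x + g(A)y = 0 with c ≠ 0. Pairing with x turns orthogonality to the orbit of y into
-- ⟨x, x⟩ = 0, and ℚ is ordered.
--
-- The vector e_v + e_u comes from the identity ⟨e_v - e_u, Aᵏ(e_v + e_u)⟩ = (Aᵏ)_vv - (Aᵏ)_uu +
-- (Aᵏ)_vu - (Aᵏ)_uv: equal closed walk counts remove the first difference, symmetry the second.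
--
-- The determinant is given by expansion along row 0 alone. Cayley-Hamilton rests on the adjugate
-- identity, which needs linearity and alternation in arbitrary rows, and these have to be derived
-- from that one expansion.
--
-- Neither property of graphs in the hypotheses comes with a decision procedure, and labelled graphs
-- are compared only up to `≐`. The union bound is therefore carried out on the listed graphs, by an
-- injective code and the pigeonhole principle.

module Determinant {c ℓ} (S : CommutativeRing c ℓ) where
  open CommutativeRing S hiding (zero)
  open RingProperties ring
  open SemiringSum semiring
  open RawSemiringDefinitions (Semiring.rawSemiring semiring) using (_^_)
  open SetoidReasoning setoid
  open NaturalCoefficients commutativeSemiring using (solve; _:=_; _:+_; _:*_)

  ∣_∣ : ∀ {n} → (Fin n → Fin n → Carrier) → Carrier
  ∣_∣ {n} = det rawRing n

  sgn : ∀ {n} → Fin n → Carrier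
  sgn j = (- 1#) ^ toℕ j

  minor : ∀ {n} → (Fin (suc n) → Fin (suc n) → Carrier) → Fin (suc n) → Fin n → Fin n → Carrier
  minor M j i k = M (suc i) (punchIn j k)

  det-cong : ∀ {n} {M N : Fin n → Fin n → Carrier} → (∀ i j → M i j ≈ N i j) → ∣ M ∣ ≈ ∣ N ∣
  det-cong {zero}  eq = refl
  det-cong {suc n} eq = sum-cong-≋ λ j →
    *-congˡ {sgn j} (*-cong (eq zero j) (det-cong λ i k → eq (suc i) (punchIn j k)))

  sum-zero : ∀ {n} {t : Vector Carrier n} → (∀ i → t i ≈ 0#) → sum t ≈ 0#
  sum-zero {n} eq = trans (sum-cong-≋ eq) (sum-replicate-zero n)

  sum-neg : ∀ {n} (t : Vector Carrier n) → sum (λ i → - t i) ≈ - sum t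
  sum-neg t = begin
    sum (λ i → - t i)       ≈⟨ sum-cong-≋ (λ i → sym (-1*x≈-x (t i))) ⟩
    sum (λ i → - 1# * t i)  ≈⟨ *-distribˡ-sum (- 1#) t ⟨
    - 1# * sum t            ≈⟨ -1*x≈-x (sum t) ⟩
    - sum t                 ∎

  -x*-y≈x*y : ∀ x y → - x * - y ≈ x * y
  -x*-y≈x*y x y = begin
    - x * - y    ≈⟨ -‿distribˡ-* x (- y) ⟨
    - (x * - y)  ≈⟨ -‿cong (sym (-‿distribʳ-* x y)) ⟩
    - - (x * y)  ≈⟨ -‿involutive (x * y) ⟩
    x * y        ∎

  -- The lift keeps column 0 and lets `f` select among the columns to its right.
  punchIn-suc∘suc : ∀ {n} → (Fin n → Fin (suc (suc n))) → Fin (suc n) → Fin (suc (suc (suc n)))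
  punchIn-suc∘suc f zero    = zero
  punchIn-suc∘suc f (suc k) = suc (f k)

  -- The double Laplace expansion along two equal rows r: the terms
  -- deleting columns 0 and j in either order cancel, and the remaining
  -- terms are a sum of the same shape with column 0 always kept.

  double-expansion : ∀ {n} (r : Vector Carrier (suc (suc n)))
    (h : (Fin n → Fin (suc (suc n))) → Carrier) → (∀ {f g} → f ≗ g → h f ≈ h g) →
    (∑[ j < suc (suc n) ] (sgn j * (r j * ∑[ l < suc n ]
       (sgn l * (r (punchIn j l) * h (punchIn j ∘ punchIn l)))))) ≈ 0#
  double-expansion-tail : ∀ {n} (r : Vector Carrier (suc (suc n)))
    (h : (Fin n → Fin (suc (suc n))) → Carrier) → (∀ {f g} → f ≗ g → h f ≈ h g) →
    (∑[ j < suc n ] (sgn j * (r (suc j) * ∑[ l < n ]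
       (sgn l * (r (suc (punchIn j l)) * h (punchIn (suc j) ∘ punchIn (suc l))))))) ≈ 0#

  double-expansion-tail {zero}  r h h-cong = sum-zero λ j →
    trans (*-congˡ (zeroʳ (r (suc j)))) (zeroʳ (sgn j))
  double-expansion-tail {suc n} r h h-cong = begin
    _ ≈⟨ sum-cong-≋ (λ j → *-congˡ {sgn j} (*-congˡ {r (suc j)} (sum-cong-≋ λ l →
           *-congˡ {sgn l} (*-congˡ {r (suc (punchIn j l))} (h-cong (keep j l)))))) ⟩
    -- Since `h` is arbitrary, it can absorb the kept column 0; what remains is an expansion of the
    -- same form with one column fewer.
    _ ≈⟨ double-expansion (r ∘ suc) (h ∘ punchIn-suc∘suc) (λ f≗g → h-cong (lift f≗g)) ⟩
    0# ∎
    where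
    keep : ∀ (j : Fin (suc (suc n))) l →
      punchIn (suc j) ∘ punchIn (suc l) ≗ punchIn-suc∘suc (punchIn j ∘ punchIn l)
    keep j l zero    = ≡.refl
    keep j l (suc k) = ≡.refl
    lift : ∀ {f g : Fin n → Fin (suc (suc n))} → f ≗ g → punchIn-suc∘suc f ≗ punchIn-suc∘suc g
    lift f≗g zero    = ≡.refl
    lift f≗g (suc k) = ≡.cong suc (f≗g k)

  double-expansion {n} r h h-cong = begin
    1# * (r zero * sum first) + sum
      (λ j → (- 1# * sgn j) * (r (suc j) * (1# * (r zero * h (p j)) + sum (rest j))))
      ≈⟨ +-cong lhs (trans (sum-cong-≋ split)
           (trans (∑-distrib-+ (λ j → - X j) (λ j → Y j))
             (+-cong (sum-neg X) (double-expansion-tail r h h-cong)))) ⟩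
    sum X + (- sum X + 0#)
      ≈⟨ +-congˡ (+-identityʳ _) ⟩
    sum X + - sum X
      ≈⟨ -‿inverseʳ _ ⟩
    0# ∎
    where
    first : Vector Carrier (suc n)
    first l = sgn l * (r (suc l) * h (suc ∘ punchIn l))
    p : Fin (suc n) → Fin n → Fin (suc (suc n))
    p j k = suc (punchIn j k)
    T rest : Fin (suc n) → Vector Carrier n
    T j l = sgn l * (r (suc (punchIn j l)) * h (punchIn (suc j) ∘ punchIn (suc l)))
    rest j l = (- 1# * sgn l) * (r (suc (punchIn j l)) * h (punchIn (suc j) ∘ punchIn (suc l)))
    X Y : Vector Carrier (suc n)
    X j = sgn j * (r (suc j) * (r zero * h (p j)))
    Y j = sgn j * (r (suc j) * sum (T j))
    lhs : 1# * (r zero * sum first) ≈ sum X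
    lhs = begin
      1# * (r zero * sum first) ≈⟨ *-identityˡ _ ⟩
      r zero * sum first        ≈⟨ *-distribˡ-sum (r zero) first ⟩
      sum (λ l → r zero * first l) ≈⟨ sum-cong-≋ (λ l →
        solve 4 (λ a b c d → (a :* (b :* (c :* d))) := (b :* (c :* (a :* d)))) refl (r zero) (sgn l)
          (r (suc l)) (h (p l))) ⟩
      sum X ∎
    rest-neg : ∀ j → sum (rest j) ≈ - sum (T j)
    rest-neg j = trans (sum-cong-≋ {_} {rest j} {λ l → - T j l} λ l → trans
      (*-assoc (- 1#) (sgn l) _) (-1*x≈-x _)) (sum-neg (T j))
    -- Deleting column `suc j` first brings a factor -1. If the second deleted column is not column
    -- 0, its index brings another -1 and the signs cancel.
    split : ∀ j → (- 1# * sgn j) *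
      (r (suc j) * (1# * (r zero * h (p j)) + sum (rest j))) ≈ - X j + Y j
    split j = begin
      _ ≈⟨ *-cong (-1*x≈-x (sgn j)) (*-congˡ (+-cong (*-identityˡ _) (rest-neg j))) ⟩
      - sgn j * (r (suc j) * (r zero * h (p j) + - sum (T j)))
        ≈⟨ solve 5 (λ s a b c t → (s :* (a :* (b :* c :+ t))) :=
             ((s :* (a :* (b :* c))) :+ (s :* (a :* t)))) refl (- sgn j) (r (suc j)) (r zero)
               (h (p j)) (- sum (T j)) ⟩
      - sgn j * (r (suc j) * (r zero * h (p j))) + - sgn j * (r (suc j) * - sum (T j))
        ≈⟨ +-cong (sym (-‿distribˡ-* _ _))
             (trans (*-congˡ (sym (-‿distribʳ-* _ _))) (-x*-y≈x*y (sgn j) _)) ⟩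
      - X j + Y j ∎

  -- Linearity and alternation in the rows

  infixl 9 _[_≔_]

  _[_≔_] : ∀ {n} → (Fin n → Fin n → Carrier) → Fin n → Vector Carrier n → Fin n → Fin n → Carrier
  M [ k ≔ b ] = updateAt M k (const b)

  minor-≔ : ∀ {n} (M : Fin (suc n) → Fin (suc n) → Carrier) k b j i l →
    minor (M [ suc k ≔ b ]) j i l ≡ (minor M j [ k ≔ b ∘ punchIn j ]) i l
  minor-≔ M k b j i l =
    ≡.cong-app (Vector.map-updateAt {f = λ row → row ∘ punchIn j} {g = const b}
      {h = const (b ∘ punchIn j)}
      (λ _ → ≡.refl) (M ∘ suc) k i) l

  ≔-cong : ∀ {n} (M : Fin n → Fin n → Carrier) k {a b : Vector Carrier n} →
    (∀ j → a j ≈ b j) → ∀ i j → (M [ k ≔ a ]) i j ≈ (M [ k ≔ b ]) i j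
  ≔-cong M zero    a≈b zero    j = a≈b j
  ≔-cong M zero    a≈b (suc i) j = refl
  ≔-cong M (suc k) a≈b zero    j = refl
  ≔-cong {suc n} M (suc k) {a} {b} a≈b (suc i) j with i Fin.≟ k
  ... | yes ≡.refl = trans (reflexive (≡.cong-app (Vector.updateAt-updates k (M ∘ suc)) j))
                    (trans (a≈b j) (sym (reflexive
                      (≡.cong-app (Vector.updateAt-updates k (M ∘ suc)) j))))
  ... | no  i≢k    = trans (reflexive (≡.cong-app (Vector.updateAt-minimal i k (M ∘ suc) i≢k) j))
                    (sym (reflexive (≡.cong-app (Vector.updateAt-minimal i k (M ∘ suc) i≢k) j)))

  -- Replacing row 0 leaves all minors alone, and replacing a later row acts inside each minor.
  -- Additivity and homogeneity are merged into the one form that `linear-functional` expects.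
  det-row-linear : ∀ {n} (M : Fin n → Fin n → Carrier) k s (a b : Vector Carrier n) →
    ∣ M [ k ≔ (λ j → s * a j + b j) ] ∣ ≈ s * ∣ M [ k ≔ a ] ∣ + ∣ M [ k ≔ b ] ∣
  det-row-linear {suc n} M zero s a b = begin
    sum (λ j → sgn j * ((s * a j + b j) * D j))
      ≈⟨ sum-cong-≋ (λ j → solve 5 (λ g s a b d → (g :* ((s :* a :+ b) :* d)) :=
           (s :* (g :* (a :* d)) :+ g :* (b :* d))) refl (sgn j) s (a j) (b j) (D j)) ⟩
    sum (λ j → s * (sgn j * (a j * D j)) + sgn j * (b j * D j))
      ≈⟨ ∑-distrib-+ (λ j → s * (sgn j * (a j * D j))) (λ j → sgn j * (b j * D j)) ⟩
    sum (λ j → s * (sgn j * (a j * D j))) + sum (λ j → sgn j * (b j * D j))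
      ≈⟨ +-congʳ (sym (*-distribˡ-sum s (λ j → sgn j * (a j * D j)))) ⟩
    _ ∎
    where
    D : Vector Carrier (suc n)
    D j = ∣ minor M j ∣
  det-row-linear {suc n} M (suc k) s a b = begin
    sum (λ j → sgn j * (M zero j * ∣ minor (M [ suc k ≔ ab ]) j ∣))
      ≈⟨ sum-cong-≋ (λ j → *-congˡ {sgn j} (*-congˡ {M zero j} (trans (at ab j)
           (trans (det-row-linear (minor M j) k s (a ∘ punchIn j) (b ∘ punchIn j))
             (+-cong (*-congˡ (sym (at a j))) (sym (at b j))))))) ⟩
    sum (λ j → sgn j * (M zero j * (s * D a j + D b j)))
      ≈⟨ sum-cong-≋ (λ j → solve 5 (λ g m s a b → (g :* (m :* (s :* a :+ b))) :=
           (s :* (g :* (m :* a)) :+ g :* (m :* b))) refl (sgn j) (M zero j) s (D a j) (D b j)) ⟩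
    sum (λ j → s * (sgn j * (M zero j * D a j)) + sgn j * (M zero j * D b j))
      ≈⟨ ∑-distrib-+ (λ j → s * (sgn j * (M zero j * D a j))) (λ j → sgn j * (M zero j * D b j)) ⟩
    sum (λ j → s * (sgn j * (M zero j * D a j))) + sum (λ j → sgn j * (M zero j * D b j))
      ≈⟨ +-congʳ (sym (*-distribˡ-sum s (λ j → sgn j * (M zero j * D a j)))) ⟩
    _ ∎
    where
    ab : Vector Carrier (suc n)
    ab j = s * a j + b j
    D : Vector Carrier (suc n) → Vector Carrier (suc n)
    D b j = ∣ minor (M [ suc k ≔ b ]) j ∣
    at : ∀ b j → D b j ≈ ∣ minor M j [ k ≔ b ∘ punchIn j ] ∣
    at b j = det-cong λ i l → reflexive (minor-≔ M k b j i l)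

  det-row-+ : ∀ {n} (M : Fin n → Fin n → Carrier) k (a b : Vector Carrier n) →
    ∣ M [ k ≔ (λ j → a j + b j) ] ∣ ≈ ∣ M [ k ≔ a ] ∣ + ∣ M [ k ≔ b ] ∣
  det-row-+ M k a b = begin
    _ ≈⟨ det-cong (≔-cong M k λ j → +-congʳ (sym (*-identityˡ (a j)))) ⟩
    _ ≈⟨ det-row-linear M k 1# a b ⟩
    _ ≈⟨ +-congʳ (*-identityˡ _) ⟩
    _ ∎

  det-minors-zero : ∀ {n} (M : Fin (suc n) → Fin (suc n) → Carrier) →
    (∀ j → ∣ minor M j ∣ ≈ 0#) → ∣ M ∣ ≈ 0#
  det-minors-zero M eq = sum-zero λ j →
    trans (*-congˡ (trans (*-congˡ (eq j)) (zeroʳ (M zero j)))) (zeroʳ (sgn j))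

  det-equal-rows-01 : ∀ {n} (M : Fin (suc (suc n)) → Fin (suc (suc n)) → Carrier) →
    (∀ k → M zero k ≈ M (suc zero) k) → ∣ M ∣ ≈ 0#
  det-equal-rows-01 M eq = begin
    ∣ M ∣ ≈⟨ sum-cong-≋ (λ j → *-congˡ {sgn j} (*-congˡ {M zero j} (sum-cong-≋ λ l →
               *-congˡ {sgn l} (*-congʳ {∣ (λ i k → M (suc (suc i)) (punchIn j (punchIn l k))) ∣}
                 (sym (eq (punchIn j l))))))) ⟩
    _     ≈⟨ double-expansion (M zero) (λ f → ∣ (λ i k → M (suc (suc i)) (f k)) ∣)
               (λ f≗g → det-cong λ i k → reflexive (≡.cong (M (suc (suc i))) (f≗g k))) ⟩
    0#    ∎

  det-equal-rows-via-1 : ∀ {n} (M : Fin (suc (suc n)) → Fin (suc (suc n)) → Carrier) j →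
    (∀ k → M zero k ≈ M (suc (suc j)) k) →
    (∀ N → (∀ k → N (suc zero) k ≈ N (suc (suc j)) k) → ∣ N ∣ ≈ 0#) →
    ∣ M ∣ ≈ 0#
  det-equal-rows-via-1 {n} M j eq zero-1-j = begin
    ∣ M ∣                          ≈⟨ det-cong M≈N ⟩
    ∣ N s r ∣                      ≈⟨ +-identityˡ _ ⟨
    0# + ∣ N s r ∣                 ≈⟨ +-congʳ (sym (equal-tail s)) ⟩
    ∣ N s s ∣ + ∣ N s r ∣          ≈⟨ det-row-+ (M [ one ≔ s ]) j₂ s r ⟨
    ∣ N s s+r ∣                    ≈⟨ +-identityʳ _ ⟨
    ∣ N s s+r ∣ + 0#               ≈⟨ +-congˡ (sym (det-equal-rows-01 (N r s+r) (λ k → refl))) ⟩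
    ∣ N s s+r ∣ + ∣ N r s+r ∣      ≈⟨ +-cong (swap s s+r) (swap r s+r) ⟩
    ∣ M [ j₂ ≔ s+r ] [ one ≔ s ] ∣ + ∣ M [ j₂ ≔ s+r ] [ one ≔ r ] ∣
                                   ≈⟨ det-row-+ (M [ j₂ ≔ s+r ]) one s r ⟨
    ∣ M [ j₂ ≔ s+r ] [ one ≔ s+r ] ∣ ≈⟨ swap s+r s+r ⟨
    ∣ N s+r s+r ∣                  ≈⟨ equal-tail s+r ⟩
    0#                             ∎
    where
    one j₂ : Fin (suc (suc n))
    one = suc zero
    j₂  = suc (suc j)
    r s s+r : Vector Carrier (suc (suc n))
    r = M zero
    s = M one
    s+r k = s k + r k
    N : Vector Carrier (suc (suc n)) → Vector Carrier (suc (suc n)) → Fin (suc (suc n)) → Fin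
      (suc (suc n)) → Carrier
    N x y = M [ one ≔ x ] [ j₂ ≔ y ]
    M≈N : ∀ i k → M i k ≈ N s r i k
    M≈N zero          k = refl
    M≈N (suc zero)    k = refl
    M≈N (suc (suc i)) k with i Fin.≟ j
    ... | yes ≡.refl = trans (sym (eq k))
      (reflexive (≡.cong-app (≡.sym (Vector.updateAt-updates i (λ i → M (suc (suc i))))) k))
    ... | no i≢j = reflexive (≡.cong-app
      (≡.sym (Vector.updateAt-minimal i j (λ i → M (suc (suc i))) i≢j)) k)
    swap : ∀ x y → ∣ N x y ∣ ≈ ∣ M [ j₂ ≔ y ] [ one ≔ x ] ∣
    swap x y = det-cong λ i k → reflexive
      (≡.cong-app (Vector.updateAt-commutes j₂ one {f = const y} {g = const x} (λ ()) M i) k)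
    equal-tail : ∀ x → ∣ N x x ∣ ≈ 0#
    equal-tail x = zero-1-j (N x x) λ k →
      reflexive (≡.cong-app (≡.sym (Vector.updateAt-updates j (λ i → M (suc (suc i))))) k)

  det-alternating-< : ∀ {n} (M : Fin n → Fin n → Carrier) i j → i Fin.< j →
    (∀ k → M i k ≈ M j k) → ∣ M ∣ ≈ 0#
  det-alternating-< {suc (suc n)} M zero (suc zero) _ eq = det-equal-rows-01 M eq
  det-alternating-< {suc (suc n)} M zero (suc (suc j)) _ eq =
    det-equal-rows-via-1 M j eq λ N N₁≈Nⱼ →
    det-minors-zero N λ l → det-alternating-< {suc n} (minor N l) zero (suc j) (ℕ.s≤s ℕ.z≤n)
      (λ k → N₁≈Nⱼ (punchIn l k))
  det-alternating-< {suc n} M (suc i) (suc j) (ℕ.s≤s i<j) eq = det-minors-zero M λ l →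
    det-alternating-< {n} (minor M l) i j i<j (λ k → eq (punchIn l k))

  det-alternating : ∀ {n} (M : Fin n → Fin n → Carrier) i j → i ≢ j →
    (∀ k → M i k ≈ M j k) → ∣ M ∣ ≈ 0#
  det-alternating M i j i≢j eq with Fin.<-cmp i j
  ... | tri< i<j _ _ = det-alternating-< M i j i<j eq
  ... | tri≈ _ i≡j _ = contradiction i≡j i≢j
  ... | tri> _ _ j<i = det-alternating-< M j i j<i (λ k → sym (eq k))

  -- The adjugate

  δ : ∀ {n} → Fin n → Fin n → Carrier
  δ i j = if does (i Fin.≟ j) then 1# else 0#

  -- Applied to the determinant as a function of one row, this replaces Laplace expansion along that
  -- row; applied to an entry of P(A)x, it reduces Cayley-Hamilton to basis vectors.
  linear-functional : ∀ {n} (f : Vector Carrier n → Carrier) →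
    (∀ {a b} → (∀ j → a j ≈ b j) → f a ≈ f b) →
    (∀ s a b → f (λ j → s * a j + b j) ≈ s * f a + f b) →
    ∀ b → f b ≈ ∑[ j < n ] (b j * f (δ j))
  -- In dimension 0 all vectors agree, so linearity yields `f b + f b ≈ f b`.
  linear-functional {zero} f f-cong f-linear b = x+x≈x⇒x≈0 (f b) (begin
    f b + f b             ≈⟨ +-congʳ (*-identityˡ (f b)) ⟨
    1# * f b + f b        ≈⟨ f-linear 1# b b ⟨
    f (λ j → 1# * b j + b j) ≈⟨ f-cong (λ ()) ⟩
    f b                   ∎)
  linear-functional {suc n} f f-cong f-linear b = begin
    f b ≈⟨ f-cong decompose ⟩
    f (λ j → b zero * δ zero j + pad (b ∘ suc) j) ≈⟨ f-linear (b zero) (δ zero) (pad (b ∘ suc)) ⟩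
    b zero * f (δ zero) + f (pad (b ∘ suc))
      ≈⟨ +-congˡ (linear-functional (f ∘ pad) (λ a≈b → f-cong (pad-cong a≈b))
                   (λ s x y → trans (f-cong (pad-linear s x y)) (f-linear s (pad x) (pad y)))
                     (b ∘ suc)) ⟩
    b zero * f (δ zero) + sum (λ j → b (suc j) * f (pad (δ j)))
      ≈⟨ +-congˡ (sum-cong-≋ λ j → *-congˡ {b (suc j)}
           (f-cong λ { zero → refl ; (suc k) → refl })) ⟩
    _ ∎
    where
    pad : Vector Carrier n → Vector Carrier (suc n)
    pad a zero    = 0#
    pad a (suc j) = a j
    pad-cong : ∀ {x y} → (∀ j → x j ≈ y j) → ∀ j → pad x j ≈ pad y j
    pad-cong eq zero    = refl
    pad-cong eq (suc j) = eq j
    pad-linear : ∀ s x y j → pad (λ j → s * x j + y j) j ≈ s * pad x j + pad y j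
    pad-linear s x y zero    = sym (trans (+-identityʳ _) (zeroʳ s))
    pad-linear s x y (suc j) = refl
    decompose : ∀ j → b j ≈ b zero * δ zero j + pad (b ∘ suc) j
    decompose zero    = sym (trans (+-identityʳ _) (*-identityʳ (b zero)))
    decompose (suc j) = sym (trans (+-congʳ (zeroʳ (b zero))) (+-identityˡ _))

  -- The signed minor, obtained with no bookkeeping of signs by putting a unit vector into row `k`.
  cofactor : ∀ {n} → (Fin n → Fin n → Carrier) → Fin n → Fin n → Carrier
  cofactor M k j = ∣ M [ k ≔ δ j ] ∣

  -- By linearity in row `k`, the sum is the determinant of `M` with row `k` replaced by row `i`.
  -- For `i` equal to `k` this is `M` itself; otherwise a row is repeated.
  adjugate-identity : ∀ {n} (M : Fin n → Fin n → Carrier) i k →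
    (∑[ j < n ] (M i j * cofactor M k j)) ≈ (if does (i Fin.≟ k) then ∣ M ∣ else 0#)
  adjugate-identity M i k = trans (sym (linear-functional (λ b → ∣ M [ k ≔ b ] ∣)
      (λ a≈b → det-cong (≔-cong M k a≈b)) (det-row-linear M k) (M i))) (value i k)
    where
    value : ∀ i k → ∣ M [ k ≔ M i ] ∣ ≈ (if does (i Fin.≟ k) then ∣ M ∣ else 0#)
    value i k with i Fin.≟ k
    ... | yes ≡.refl = det-cong λ l j → reflexive
      (≡.cong-app (Vector.updateAt-id-local k M ≡.refl l) j)
    ... | no  i≢k    = det-alternating (M [ k ≔ M i ]) i k i≢k λ j → trans
      (reflexive (≡.cong-app (Vector.updateAt-minimal i k M i≢k) j))
      (reflexive (≡.cong-app (≡.sym (Vector.updateAt-updates k M)) j))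

  det-identity : ∀ n → ∣ δ {n} ∣ ≈ 1#
  det-identity zero    = refl
  det-identity (suc n) = begin
    1# * (1# * ∣ δ {n} ∣) + sum (λ j → sgn (suc j) * (0# * D j))
      ≈⟨ +-cong (trans (*-identityˡ _) (trans (*-identityˡ _) (det-identity n)))
                (sum-zero λ j → trans (*-congˡ (zeroˡ (D j))) (zeroʳ (sgn (suc j)))) ⟩
    1# + 0# ≈⟨ +-identityʳ 1# ⟩
    1# ∎
    where
    D : Vector Carrier n
    D j = ∣ minor δ (suc j) ∣

open ≡ using (refl; sym; trans; cong; cong₂; subst)
open +-*-Solver using (solve; _:=_; _:+_; _:*_; con; :-_)

private module ℤSolver = ℤ.+-*-Solver

-- Counting labelled graphs

_≐?_ : ∀ {n} (G H : Graph n) → Dec (G ≐ H)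
G ≐? H = Fin.all? λ i → Fin.all? λ j → adj G i j Bool.≟ adj H i j

bit : Bool → Fin 2
bit false = zero
bit true  = suc zero

bit-injective : ∀ {a b} → bit a ≡ bit b → a ≡ b
bit-injective {false} {false} eq = refl
bit-injective {true}  {true}  eq = refl

tail-graph : ∀ {n} → Graph (suc n) → Graph n
tail-graph G = record
  { adj         = λ i j → adj G (suc i) (suc j)
  ; symmetric   = λ i j → symmetric G (suc i) (suc j)
  ; irreflexive = λ i → irreflexive G (suc i)
  }

-- Vertex 0 contributes n possible edges: Pascal's rule in the exponent.
numberOfGraphs-suc : ∀ n → 2 ℕ.^ n ℕ.* numberOfGraphs n ≡ numberOfGraphs (suc n)
numberOfGraphs-suc n = trans (sym (ℕ.^-distribˡ-+-* 2 n (n ℕ.C 2))) (cong (2 ℕ.^_)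
  (trans (cong (ℕ._+ n ℕ.C 2) (sym (ℕ.nC1≡n n))) (ℕ.nCk+nC[k+1]≡[n+1]C[k+1] n 1)))

-- Row 0 to the right of the diagonal, paired with the code of the graph on the other vertices;
-- symmetry and irreflexivity restore the rest. The injection feeds the pigeonhole bound on lists of
-- distinct graphs.
encode : ∀ {n} → Graph n → Fin (numberOfGraphs n)
encode {zero}  G = zero
encode {suc n} G = cast (numberOfGraphs-suc n)
  (combine (Fin.funToFin (λ j → bit (adj G zero (suc j)))) (encode (tail-graph G)))

funToFin-injective : ∀ {m n} (f g : Fin m → Fin n) → Fin.funToFin f ≡ Fin.funToFin g → ∀ i →
  f i ≡ g i
funToFin-injective f g eq i = trans (sym (Fin.finToFun-funToFin f i))
  (trans (cong (λ k → Fin.finToFun k i) eq) (Fin.finToFun-funToFin g i))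

encode-injective : ∀ {n} (G H : Graph n) → encode G ≡ encode H → G ≐ H
encode-injective {suc n} G H eq = λ
  { zero    zero    → trans (irreflexive G zero) (sym (irreflexive H zero))
  ; zero    (suc j) → row j
  ; (suc i) zero    → trans (symmetric G (suc i) zero) (trans (row i) (symmetric H zero (suc i)))
  ; (suc i) (suc j) → encode-injective (tail-graph G) (tail-graph H) (proj₂ parts) i j
  }
  where
  row-code : Graph (suc n) → Fin (2 ℕ.^ n)
  row-code G = Fin.funToFin (λ j → bit (adj G zero (suc j)))
  combined : combine (row-code G) (encode (tail-graph G)) ≡ combine (row-code H)
    (encode (tail-graph H))
  combined = Fin.toℕ-injective (trans (sym (Fin.toℕ-cast (numberOfGraphs-suc n) _))
    (trans (cong toℕ eq) (Fin.toℕ-cast (numberOfGraphs-suc n) _)))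
  parts : row-code G ≡ row-code H × encode (tail-graph G) ≡ encode (tail-graph H)
  parts = Fin.combine-injective (row-code G) (encode (tail-graph G)) (row-code H)
    (encode (tail-graph H)) combined
  row : ∀ j → adj G zero (suc j) ≡ adj H zero (suc j)
  row j = bit-injective (funToFin-injective _ _ (proj₁ parts) j)

Distinct : ∀ {n} → List (Graph n) → Set
Distinct = AllPairs (λ G H → ¬ (G ≐ H))

AllPairs-lookup : ∀ {a r} {A : Set a} {R : A → A → Set r} {xs} → AllPairs R xs →
  ∀ {i j} → i Fin.< j → R (lookup xs i) (lookup xs j)
AllPairs-lookup {xs = x ∷ xs} (r ∷ _)  {zero}  {suc j} _ = All.lookup r (∈-lookup {xs = xs} j)
AllPairs-lookup (_ ∷ rs) {suc i} {suc j} (s≤s i<j)       = AllPairs-lookup rs i<j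

length-distinct : ∀ {n} {Gs : List (Graph n)} → Distinct Gs → length Gs ℕ.≤ numberOfGraphs n
length-distinct {Gs = Gs} distinct = ℕ.≮⇒≥ λ more →
  let i , j , i<j , eq = Fin.pigeonhole more (encode ∘ lookup Gs)
  in AllPairs-lookup distinct i<j (encode-injective (lookup Gs i) (lookup Gs j) eq)

length-filter-¬ : ∀ {a p} {A : Set a} {P : A → Set p} (P? : ∀ x → Dec (P x)) xs →
  length (filter P? xs) ℕ.+ length (filter (¬? ∘ P?) xs) ≡ length xs
length-filter-¬ P? []       = refl
length-filter-¬ P? (x ∷ xs) with P? x
... | yes _ = cong suc (length-filter-¬ P? xs)
... | no  _ = trans (ℕ.+-suc _ _) (cong suc (length-filter-¬ P? xs))

-- The intersection of two events, taken on their listed members, where membership up to `≐` is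
-- decidable.
common : ∀ {n} → List (Graph n) → List (Graph n) → List (Graph n)
common Gs Hs = filter (λ G → any? (G ≐?_) Hs) Gs

-- The members of `Gs` not found in `Hs`, followed by `Hs`, still form a list of distinct graphs, so
-- together they number at most `numberOfGraphs n`.
length-common : ∀ {n} {Gs Hs : List (Graph n)} → Distinct Gs → Distinct Hs →
  length Gs ℕ.+ length Hs ℕ.≤ length (common Gs Hs) ℕ.+ numberOfGraphs n
length-common {n} {Gs} {Hs} dGs dHs = begin
  length Gs ℕ.+ length Hs
    ≡⟨ cong (ℕ._+ length Hs) (length-filter-¬ in? Gs) ⟨
  length (common Gs Hs) ℕ.+ length Os ℕ.+ length Hs    ≡⟨ ℕ.+-assoc (length (common Gs Hs)) _ _ ⟩
  length (common Gs Hs) ℕ.+ (length Os ℕ.+ length Hs)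
    ≡⟨ cong (length (common Gs Hs) ℕ.+_) (List.length-++ Os) ⟨
  length (common Gs Hs) ℕ.+ length (Os ++ Hs)
    ≤⟨ ℕ.+-monoʳ-≤ (length (common Gs Hs)) (length-distinct distinct) ⟩
  length (common Gs Hs) ℕ.+ numberOfGraphs n           ∎
  where
  open ℕ.≤-Reasoning
  in? : (G : Graph n) → Dec (Any (G ≐_) Hs)
  in? G = any? (G ≐?_) Hs
  Os : List (Graph n)
  Os = filter (¬? ∘ in?) Gs
  distinct : Distinct (Os ++ Hs)
  distinct = AllPairs.++⁺ (AllPairs.filter⁺ (¬? ∘ in?) dGs) dHs
    (All.map (λ {G} ¬any → All.¬Any⇒All¬ Hs ¬any) (All.all-filter (¬? ∘ in?) Gs))

-- Probabilities as fractions

frac : ℕ → (N : ℕ) .{{_ : NonZero N}} → ℚ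
frac m N = (+ m) ℚ./ N

frac-+ : ∀ a b N .{{_ : NonZero N}} → frac (a ℕ.+ b) N ≡ frac a N ℚ.+ frac b N
frac-+ a b (suc d) = ℚ.toℚᵘ-injective (begin
  ℚ.toℚᵘ (frac (a ℕ.+ b) (suc d))                       ≈⟨ ℚ.toℚᵘ-fromℚᵘ (ℚᵘ.mkℚᵘ (+ (a ℕ.+ b)) d) ⟩
  ℚᵘ.mkℚᵘ (+ (a ℕ.+ b)) d                               ≈⟨ ℚᵘ.*≡* cross ⟩
  ℚᵘ.mkℚᵘ (+ a) d ℚᵘ.+ ℚᵘ.mkℚᵘ (+ b) d
    ≈⟨ ℚᵘ.+-cong (ℚ.toℚᵘ-fromℚᵘ (ℚᵘ.mkℚᵘ (+ a) d)) (ℚ.toℚᵘ-fromℚᵘ (ℚᵘ.mkℚᵘ (+ b) d)) ⟨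
  ℚ.toℚᵘ (frac a (suc d)) ℚᵘ.+ ℚ.toℚᵘ (frac b (suc d))
    ≈⟨ ℚ.toℚᵘ-homo-+ (frac a (suc d)) (frac b (suc d)) ⟨
  ℚ.toℚᵘ (frac a (suc d) ℚ.+ frac b (suc d))            ∎)
  where
  open ℚᵘ.≃-Reasoning
  D : ℤ.ℤ
  D = + suc d
  cross : + (a ℕ.+ b) ℤ.* (D ℤ.* D) ≡ (+ a ℤ.* D ℤ.+ + b ℤ.* D) ℤ.* D
  cross = trans (cong (ℤ._* (D ℤ.* D)) (ℤ.pos-+ a b))
    (ℤSolver.solve 3 (λ a b D → ((a ℤSolver.:+ b) ℤSolver.:* (D ℤSolver.:* D)) ℤSolver.:=
      ((a ℤSolver.:* D ℤSolver.:+ b ℤSolver.:* D) ℤSolver.:* D)) refl (+ a) (+ b) D)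

frac-self : ∀ N .{{_ : NonZero N}} → frac N N ≡ 1ℚ
frac-self (suc d) = ℚ.toℚᵘ-injective
  (ℚᵘ.≃-trans (ℚ.toℚᵘ-fromℚᵘ (ℚᵘ.mkℚᵘ (+ suc d) d)) (ℚᵘ.*≡* (ℤ.*-comm (+ suc d) (+ 1))))

frac-mono-≤ : ∀ {a b} N .{{_ : NonZero N}} → a ℕ.≤ b → frac a N ℚ.≤ frac b N
frac-mono-≤ {a} {b} N a≤b = begin
  frac a N                       ≡⟨ ℚ.+-identityʳ _ ⟨
  frac a N ℚ.+ 0ℚ
    ≤⟨ ℚ.+-monoʳ-≤ (frac a N) (ℚ.nonNegative⁻¹ _ {{ℚ.normalize-nonNeg (b ℕ.∸ a) N}}) ⟩
  frac a N ℚ.+ frac (b ℕ.∸ a) N  ≡⟨ frac-+ a (b ℕ.∸ a) N ⟨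
  frac (a ℕ.+ (b ℕ.∸ a)) N       ≡⟨ cong (λ m → frac m N) (ℕ.m+[n∸m]≡n a≤b) ⟩
  frac b N                       ∎
  where open ℚ.≤-Reasoning

-- Two losses of ε/2 add up to ε; the 1 that is subtracted is the fraction `N / N`, from the bound
-- on the union.
inclusion-exclusion : ∀ ε a b c N .{{_ : NonZero N}} → a ℕ.+ b ℕ.≤ c ℕ.+ N →
  1ℚ ℚ.- ℚ.½ ℚ.* ε ℚ.≤ frac a N → 1ℚ ℚ.- ℚ.½ ℚ.* ε ℚ.≤ frac b N → 1ℚ ℚ.- ε ℚ.≤ frac c N
inclusion-exclusion ε a b c N a+b≤c+N ≤a ≤b = begin
  1ℚ ℚ.- ε
    ≡⟨ solve 1 (λ ε → (con 1ℚ :+ :- ε) :=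
         (((con 1ℚ :+ :- (con ℚ.½ :* ε)) :+ (con 1ℚ :+ :- (con ℚ.½ :* ε))) :+ :- con 1ℚ)) refl ε ⟩
  ((1ℚ ℚ.- ℚ.½ ℚ.* ε) ℚ.+ (1ℚ ℚ.- ℚ.½ ℚ.* ε)) ℚ.- 1ℚ
    ≤⟨ ℚ.+-monoˡ-≤ (ℚ.- 1ℚ) (ℚ.+-mono-≤ ≤a ≤b) ⟩
  (frac a N ℚ.+ frac b N) ℚ.- 1ℚ
    ≡⟨ cong (ℚ._- 1ℚ) (frac-+ a b N) ⟨
  frac (a ℕ.+ b) N ℚ.- 1ℚ
    ≤⟨ ℚ.+-monoˡ-≤ (ℚ.- 1ℚ) (frac-mono-≤ N a+b≤c+N) ⟩
  frac (c ℕ.+ N) N ℚ.- 1ℚ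
    ≡⟨ cong (ℚ._- 1ℚ) (trans (frac-+ c N N) (cong (frac c N ℚ.+_) (frac-self N))) ⟩
  (frac c N ℚ.+ 1ℚ) ℚ.- 1ℚ
    ≡⟨ solve 1 (λ c → ((c :+ con 1ℚ) :+ :- con 1ℚ) := c) refl (frac c N) ⟩
  frac c N ∎
  where open ℚ.≤-Reasoning

module _ {P Q E : ∀ {n} → Graph n → Set}
  (Q-resp : ∀ {n} {G H : Graph n} → G ≐ H → Q H → Q G)
  (P∧Q⇒E : ∀ {n} {G : Graph n} → P G → Q G → E G) where

  -- Members of the common list are taken from the list for `P`, so it is `Q` that is carried across
  -- `≐`.
  almost-surely-∧ : AsymptoticallyAlmostSurely P → AsymptoticallyAlmostSurely Q →
    AsymptoticallyAlmostSurely E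
  almost-surely-∧ aasP aasQ ε 0<ε = N₁ ℕ.⊔ N₂ , λ n N≤n → combined n
    (proj₂ (aasP ½ε 0<½ε) n (ℕ.≤-trans (ℕ.m≤m⊔n N₁ N₂) N≤n))
    (proj₂ (aasQ ½ε 0<½ε) n (ℕ.≤-trans (ℕ.m≤n⊔m N₁ N₂) N≤n))
    where
    ½ε : ℚ
    ½ε = ℚ.½ ℚ.* ε
    0<½ε : 0ℚ ℚ.< ½ε
    0<½ε = subst (ℚ._< ½ε) (ℚ.*-zeroʳ ℚ.½) (ℚ.*-monoʳ-<-pos ℚ.½ 0<ε)
    N₁ N₂ : ℕ
    N₁ = proj₁ (aasP ½ε 0<½ε)
    N₂ = proj₁ (aasQ ½ε 0<½ε)
    combined : ∀ n → ProbabilityAtLeast n (1ℚ ℚ.- ½ε) P → ProbabilityAtLeast n (1ℚ ℚ.- ½ε) Q →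
      ProbabilityAtLeast n (1ℚ ℚ.- ε) E
    combined n (Gs , dGs , PGs , ≤Gs) (Hs , dHs , QHs , ≤Hs) =
        common Gs Hs
      , AllPairs.filter⁺ in? dGs
      , All.zipWith (λ (p , any) → let q , G≐H = All.lookupAny QHs any in P∧Q⇒E p (Q-resp G≐H q))
          (All.filter⁺ in? PGs , All.all-filter in? Gs)
      , inclusion-exclusion ε (length Gs) (length Hs) (length (common Gs Hs)) (numberOfGraphs n)
          {{numberOfGraphs-nonZero n}} (length-common dGs dHs) ≤Gs ≤Hs
      where
      in? : (G : Graph n) → Dec (Any (G ≐_) Hs)
      in? G = any? (G ≐?_) Hs

open ≡-Reasoning

-- The ring of polynomials

scale : ℚ → Poly → Poly
scale a = List.map (a ℚ.*_)

-ₚ_ : Poly → Poly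
-ₚ_ = List.map (ℚ.-_)

coeff-+ : ∀ p q k → coeff (p +ₚ q) k ≡ coeff p k ℚ.+ coeff q k
coeff-+ []      q       k       = sym (ℚ.+-identityˡ _)
coeff-+ (a ∷ p) []      k       = sym (ℚ.+-identityʳ _)
coeff-+ (a ∷ p) (b ∷ q) zero    = refl
coeff-+ (a ∷ p) (b ∷ q) (suc k) = coeff-+ p q k

coeff-scale : ∀ a p k → coeff (scale a p) k ≡ a ℚ.* coeff p k
coeff-scale a []      k       = sym (ℚ.*-zeroʳ a)
coeff-scale a (b ∷ p) zero    = refl
coeff-scale a (b ∷ p) (suc k) = coeff-scale a p k

coeff-neg : ∀ p k → coeff (-ₚ p) k ≡ ℚ.- coeff p k
coeff-neg []      k       = refl
coeff-neg (b ∷ p) zero    = refl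
coeff-neg (b ∷ p) (suc k) = coeff-neg p k

shift-cong : ∀ {p q} → p ≈ₚ q → (0ℚ ∷ p) ≈ₚ (0ℚ ∷ q)
shift-cong p≈q zero    = refl
shift-cong p≈q (suc k) = p≈q k

coeff-∷-* : ∀ a p q k → coeff ((a ∷ p) *ₚ q) k ≡ a ℚ.* coeff q k ℚ.+ coeff (0ℚ ∷ p *ₚ q) k
coeff-∷-* a p q k = trans (coeff-+ (scale a q) (0ℚ ∷ p *ₚ q) k) (cong (ℚ._+ _) (coeff-scale a q k))

+ₚ-cong : ∀ {p p′ q q′} → p ≈ₚ p′ → q ≈ₚ q′ → (p +ₚ q) ≈ₚ (p′ +ₚ q′)
+ₚ-cong {p} {p′} {q} {q′} p≈p′ q≈q′ k = begin
  coeff (p +ₚ q) k                ≡⟨ coeff-+ p q k ⟩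
  coeff p k ℚ.+ coeff q k         ≡⟨ cong₂ ℚ._+_ (p≈p′ k) (q≈q′ k) ⟩
  coeff p′ k ℚ.+ coeff q′ k       ≡⟨ coeff-+ p′ q′ k ⟨
  coeff (p′ +ₚ q′) k              ∎

+ₚ-assoc : ∀ p q r → ((p +ₚ q) +ₚ r) ≈ₚ (p +ₚ (q +ₚ r))
+ₚ-assoc p q r k = begin
  coeff ((p +ₚ q) +ₚ r) k                    ≡⟨ coeff-+ (p +ₚ q) r k ⟩
  coeff (p +ₚ q) k ℚ.+ coeff r k             ≡⟨ cong (ℚ._+ _) (coeff-+ p q k) ⟩
  coeff p k ℚ.+ coeff q k ℚ.+ coeff r k      ≡⟨ ℚ.+-assoc (coeff p k) _ _ ⟩
  coeff p k ℚ.+ (coeff q k ℚ.+ coeff r k)    ≡⟨ cong (coeff p k ℚ.+_) (coeff-+ q r k) ⟨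
  coeff p k ℚ.+ coeff (q +ₚ r) k             ≡⟨ coeff-+ p (q +ₚ r) k ⟨
  coeff (p +ₚ (q +ₚ r)) k                    ∎

+ₚ-comm : ∀ p q → (p +ₚ q) ≈ₚ (q +ₚ p)
+ₚ-comm p q k = trans (coeff-+ p q k) (trans (ℚ.+-comm (coeff p k) _) (sym (coeff-+ q p k)))

+ₚ-identityʳ : ∀ p → (p +ₚ []) ≈ₚ p
+ₚ-identityʳ p k = trans (coeff-+ p [] k) (ℚ.+-identityʳ _)

-ₚ-inverseʳ : ∀ p → (p +ₚ (-ₚ p)) ≈ₚ []
-ₚ-inverseʳ p k = begin
  coeff (p +ₚ (-ₚ p)) k            ≡⟨ coeff-+ p (-ₚ p) k ⟩
  coeff p k ℚ.+ coeff (-ₚ p) k     ≡⟨ cong (coeff p k ℚ.+_) (coeff-neg p k) ⟩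
  coeff p k ℚ.+ ℚ.- coeff p k      ≡⟨ ℚ.+-inverseʳ (coeff p k) ⟩
  0ℚ                               ∎

-ₚ-cong : ∀ {p q} → p ≈ₚ q → (-ₚ p) ≈ₚ (-ₚ q)
-ₚ-cong {p} {q} p≈q k = trans (coeff-neg p k) (trans (cong (ℚ.-_) (p≈q k)) (sym (coeff-neg q k)))

*ₚ-congˡ : ∀ p {q q′} → q ≈ₚ q′ → (p *ₚ q) ≈ₚ (p *ₚ q′)
*ₚ-congˡ []      q≈q′ k = refl
*ₚ-congˡ (a ∷ p) {q} {q′} q≈q′ k = begin
  coeff ((a ∷ p) *ₚ q) k                          ≡⟨ coeff-∷-* a p q k ⟩
  a ℚ.* coeff q k ℚ.+ coeff (0ℚ ∷ p *ₚ q) k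
    ≡⟨ cong₂ (λ x y → a ℚ.* x ℚ.+ y) (q≈q′ k) (shift-cong (*ₚ-congˡ p q≈q′) k) ⟩
  a ℚ.* coeff q′ k ℚ.+ coeff (0ℚ ∷ p *ₚ q′) k     ≡⟨ coeff-∷-* a p q′ k ⟨
  coeff ((a ∷ p) *ₚ q′) k                         ∎

*ₚ-zeroʳ : ∀ p → (p *ₚ []) ≈ₚ []
*ₚ-zeroʳ []      k       = refl
*ₚ-zeroʳ (a ∷ p) zero    = refl
*ₚ-zeroʳ (a ∷ p) (suc k) = *ₚ-zeroʳ p k

-- Multiplication recurses on its left factor. This is the mirror rule for the right factor, which
-- makes commutativity an induction.
*ₚ-∷ : ∀ p b q → (p *ₚ (b ∷ q)) ≈ₚ (scale b p +ₚ (0ℚ ∷ p *ₚ q))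
*ₚ-∷ []      b q zero    = refl
*ₚ-∷ []      b q (suc k) = refl
*ₚ-∷ (a ∷ p) b q zero    = cong (ℚ._+ 0ℚ) (ℚ.*-comm a b)
*ₚ-∷ (a ∷ p) b q (suc k) = begin
  coeff (scale a q +ₚ p *ₚ (b ∷ q)) k
    ≡⟨ coeff-+ (scale a q) (p *ₚ (b ∷ q)) k ⟩
  coeff (scale a q) k ℚ.+ coeff (p *ₚ (b ∷ q)) k
    ≡⟨ cong (coeff (scale a q) k ℚ.+_) (trans (*ₚ-∷ p b q k) (coeff-+ (scale b p) _ k)) ⟩
  coeff (scale a q) k ℚ.+ (coeff (scale b p) k ℚ.+ z)
    ≡⟨ solve 3 (λ x y z → (x :+ (y :+ z)) := (y :+ (x :+ z))) refl (coeff (scale a q) k)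
         (coeff (scale b p) k) z ⟩
  coeff (scale b p) k ℚ.+ (coeff (scale a q) k ℚ.+ z)
    ≡⟨ cong (coeff (scale b p) k ℚ.+_) (coeff-+ (scale a q) _ k) ⟨
  coeff (scale b p) k ℚ.+ coeff ((a ∷ p) *ₚ q) k            ≡⟨ coeff-+ (scale b p) _ k ⟨
  coeff (scale b p +ₚ ((a ∷ p) *ₚ q)) k                     ∎
  where z = coeff (0ℚ ∷ p *ₚ q) k

*ₚ-comm : ∀ p q → (p *ₚ q) ≈ₚ (q *ₚ p)
*ₚ-comm []      q k = sym (*ₚ-zeroʳ q k)
*ₚ-comm (a ∷ p) q k = trans
  (+ₚ-cong {scale a q} {scale a q} (λ _ → refl) (shift-cong (*ₚ-comm p q)) k)
  (sym (*ₚ-∷ q a p k))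

-- Trailing zeros let equal polynomials be lists of different lengths, so a change of the left
-- factor is made after commuting it to the right.
*ₚ-cong : ∀ {p p′ q q′} → p ≈ₚ p′ → q ≈ₚ q′ → (p *ₚ q) ≈ₚ (p′ *ₚ q′)
*ₚ-cong {p} {p′} {q} {q′} p≈p′ q≈q′ k = begin
  coeff (p *ₚ q) k    ≡⟨ *ₚ-congˡ p q≈q′ k ⟩
  coeff (p *ₚ q′) k   ≡⟨ *ₚ-comm p q′ k ⟩
  coeff (q′ *ₚ p) k   ≡⟨ *ₚ-congˡ q′ p≈p′ k ⟩
  coeff (q′ *ₚ p′) k  ≡⟨ *ₚ-comm q′ p′ k ⟩
  coeff (p′ *ₚ q′) k  ∎

*ₚ-distribʳ : ∀ r p q → ((p +ₚ q) *ₚ r) ≈ₚ (p *ₚ r +ₚ q *ₚ r)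
*ₚ-distribʳ r []      q       k = refl
*ₚ-distribʳ r (a ∷ p) []      k = sym (+ₚ-identityʳ ((a ∷ p) *ₚ r) k)
*ₚ-distribʳ r (a ∷ p) (b ∷ q) k = begin
  coeff ((a ℚ.+ b ∷ p +ₚ q) *ₚ r) k
    ≡⟨ coeff-∷-* (a ℚ.+ b) (p +ₚ q) r k ⟩
  (a ℚ.+ b) ℚ.* coeff r k ℚ.+ coeff (0ℚ ∷ (p +ₚ q) *ₚ r) k
    ≡⟨ cong ((a ℚ.+ b) ℚ.* coeff r k ℚ.+_) (tail k) ⟩
  (a ℚ.+ b) ℚ.* coeff r k ℚ.+ (x ℚ.+ y)
    ≡⟨ solve 5 (λ a b r x y → ((a :+ b) :* r :+ (x :+ y)) := ((a :* r :+ x) :+ (b :* r :+ y))) refl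
         a b (coeff r k) x y ⟩
  (a ℚ.* coeff r k ℚ.+ x) ℚ.+ (b ℚ.* coeff r k ℚ.+ y)
    ≡⟨ cong₂ ℚ._+_ (coeff-∷-* a p r k) (coeff-∷-* b q r k) ⟨
  coeff ((a ∷ p) *ₚ r) k ℚ.+ coeff ((b ∷ q) *ₚ r) k               ≡⟨ coeff-+ ((a ∷ p) *ₚ r) _ k ⟨
  coeff ((a ∷ p) *ₚ r +ₚ (b ∷ q) *ₚ r) k                          ∎
  where
  x = coeff (0ℚ ∷ p *ₚ r) k
  y = coeff (0ℚ ∷ q *ₚ r) k
  tail : ∀ k → coeff (0ℚ ∷ (p +ₚ q) *ₚ r) k ≡ coeff (0ℚ ∷ p *ₚ r) k ℚ.+ coeff (0ℚ ∷ q *ₚ r) k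
  tail zero    = refl
  tail (suc k) = trans (*ₚ-distribʳ r p q k) (coeff-+ (p *ₚ r) _ k)

*ₚ-distribˡ : ∀ r p q → (r *ₚ (p +ₚ q)) ≈ₚ (r *ₚ p +ₚ r *ₚ q)
*ₚ-distribˡ r p q k = begin
  coeff (r *ₚ (p +ₚ q)) k        ≡⟨ *ₚ-comm r (p +ₚ q) k ⟩
  coeff ((p +ₚ q) *ₚ r) k        ≡⟨ *ₚ-distribʳ r p q k ⟩
  coeff (p *ₚ r +ₚ q *ₚ r) k
    ≡⟨ +ₚ-cong {p *ₚ r} {r *ₚ p} {q *ₚ r} {r *ₚ q} (*ₚ-comm p r) (*ₚ-comm q r) k ⟩
  coeff (r *ₚ p +ₚ r *ₚ q) k     ∎

scale-* : ∀ a p r → (scale a p *ₚ r) ≈ₚ scale a (p *ₚ r)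
scale-* a []      r k = refl
scale-* a (b ∷ p) r k = begin
  coeff ((a ℚ.* b ∷ scale a p) *ₚ r) k
    ≡⟨ coeff-∷-* (a ℚ.* b) (scale a p) r k ⟩
  a ℚ.* b ℚ.* coeff r k ℚ.+ coeff (0ℚ ∷ scale a p *ₚ r) k
    ≡⟨ cong (a ℚ.* b ℚ.* coeff r k ℚ.+_) (tail k) ⟩
  a ℚ.* b ℚ.* coeff r k ℚ.+ a ℚ.* x
    ≡⟨ solve 4 (λ a b r x → (a :* b :* r :+ a :* x) := (a :* (b :* r :+ x))) refl a b
         (coeff r k) x ⟩
  a ℚ.* (b ℚ.* coeff r k ℚ.+ x)
    ≡⟨ cong (a ℚ.*_) (coeff-∷-* b p r k) ⟨
  a ℚ.* coeff ((b ∷ p) *ₚ r) k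
    ≡⟨ coeff-scale a ((b ∷ p) *ₚ r) k ⟨
  coeff (scale a ((b ∷ p) *ₚ r)) k                                ∎
  where
  x = coeff (0ℚ ∷ p *ₚ r) k
  tail : ∀ k → coeff (0ℚ ∷ scale a p *ₚ r) k ≡ a ℚ.* coeff (0ℚ ∷ p *ₚ r) k
  tail zero    = sym (ℚ.*-zeroʳ a)
  tail (suc k) = trans (scale-* a p r k) (coeff-scale a (p *ₚ r) k)

*ₚ-assoc : ∀ p q r → ((p *ₚ q) *ₚ r) ≈ₚ (p *ₚ (q *ₚ r))
*ₚ-assoc []      q r k = refl
*ₚ-assoc (a ∷ p) q r k = begin
  coeff ((scale a q +ₚ (0ℚ ∷ p *ₚ q)) *ₚ r) k                     ≡⟨ *ₚ-distribʳ r (scale a q) _ k ⟩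
  coeff (scale a q *ₚ r +ₚ (0ℚ ∷ p *ₚ q) *ₚ r) k
    ≡⟨ +ₚ-cong {scale a q *ₚ r} {scale a (q *ₚ r)} {(0ℚ ∷ p *ₚ q) *ₚ r} (scale-* a q r) shifted k ⟩
  coeff (scale a (q *ₚ r) +ₚ (0ℚ ∷ p *ₚ (q *ₚ r))) k              ∎
  where
  shifted : ((0ℚ ∷ p *ₚ q) *ₚ r) ≈ₚ (0ℚ ∷ p *ₚ (q *ₚ r))
  shifted k = begin
    coeff ((0ℚ ∷ p *ₚ q) *ₚ r) k                                ≡⟨ coeff-∷-* 0ℚ (p *ₚ q) r k ⟩
    0ℚ ℚ.* coeff r k ℚ.+ coeff (0ℚ ∷ (p *ₚ q) *ₚ r) k
      ≡⟨ cong₂ ℚ._+_ (ℚ.*-zeroˡ (coeff r k)) (shift-cong (*ₚ-assoc p q r) k) ⟩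
    0ℚ ℚ.+ coeff (0ℚ ∷ p *ₚ (q *ₚ r)) k                         ≡⟨ ℚ.+-identityˡ _ ⟩
    coeff (0ℚ ∷ p *ₚ (q *ₚ r)) k                                ∎

*ₚ-identityˡ : ∀ p → (constant 1ℚ *ₚ p) ≈ₚ p
*ₚ-identityˡ p k = begin
  coeff (constant 1ℚ *ₚ p) k                    ≡⟨ coeff-∷-* 1ℚ [] p k ⟩
  1ℚ ℚ.* coeff p k ℚ.+ coeff (0ℚ ∷ []) k
    ≡⟨ cong₂ ℚ._+_ (ℚ.*-identityˡ (coeff p k)) (zeros k) ⟩
  coeff p k ℚ.+ 0ℚ                              ≡⟨ ℚ.+-identityʳ _ ⟩
  coeff p k                                     ∎
  where
  zeros : (0ℚ ∷ []) ≈ₚ []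
  zeros zero    = refl
  zeros (suc k) = refl

Poly-isCommutativeRing : IsCommutativeRing _≈ₚ_ _+ₚ_ _*ₚ_ -ₚ_ [] (constant 1ℚ)
Poly-isCommutativeRing = record
  { isRing = record
    { +-isAbelianGroup = record
      { isGroup = record
        { isMonoid = record
          { isSemigroup = record
            { isMagma = record
              { isEquivalence = record
                { refl  = λ _ → refl
                ; sym   = λ p≈q k → sym (p≈q k)
                ; trans = λ p≈q q≈r k → trans (p≈q k) (q≈r k)
                }
              ; ∙-cong = λ {p} {p′} {q} {q′} → +ₚ-cong {p} {p′} {q} {q′}
              }
            ; assoc = +ₚ-assoc
            }
          ; identity = (λ _ _ → refl) , +ₚ-identityʳ
          }
        ; inverse = (λ p k → trans (+ₚ-comm (-ₚ p) p k) (-ₚ-inverseʳ p k)) , -ₚ-inverseʳ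
        ; ⁻¹-cong = λ {p} {q} → -ₚ-cong {p} {q}
        }
      ; comm = +ₚ-comm
      }
    ; *-cong     = λ {p} {p′} {q} {q′} → *ₚ-cong {p} {p′} {q} {q′}
    ; *-assoc    = *ₚ-assoc
    ; *-identity = *ₚ-identityˡ , λ p k → trans (*ₚ-comm p (constant 1ℚ) k) (*ₚ-identityˡ p k)
    ; distrib    = *ₚ-distribˡ , *ₚ-distribʳ
    }
  ; *-comm = *ₚ-comm
  }

Poly-commutativeRing : CommutativeRing 0ℓ 0ℓ
Poly-commutativeRing = record { isCommutativeRing = Poly-isCommutativeRing }

-- Polynomials in a matrix

open SemiringSum (CommutativeRing.semiring ℚ.+-*-commutativeRing)
open RingProperties ℚ.+-*-ring using (-1*x≈-x)

module Detℚ = Determinant ℚ.+-*-commutativeRing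
module Detₚ = Determinant Poly-commutativeRing
open Detℚ using (δ)

sumₚ : ∀ {m} → Vector Poly m → Poly
sumₚ = SemiringSum.sum (CommutativeRing.semiring Poly-commutativeRing)

Matrix : ℕ → Set
Matrix n = Fin n → Fin n → ℚ

sum-δ : ∀ {n} (f : Vector ℚ n) i → (∑[ j < n ] (f j ℚ.* δ j i)) ≡ f i
sum-δ {suc n} f zero    = begin
  f zero ℚ.* 1ℚ ℚ.+ ∑[ j < n ] (f (suc j) ℚ.* 0ℚ)
    ≡⟨ cong₂ ℚ._+_ (ℚ.*-identityʳ (f zero)) (Detℚ.sum-zero (λ j → ℚ.*-zeroʳ (f (suc j)))) ⟩
  f zero ℚ.+ 0ℚ                                   ≡⟨ ℚ.+-identityʳ (f zero) ⟩
  f zero                                          ∎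
sum-δ {suc n} f (suc i) = begin
  f zero ℚ.* 0ℚ ℚ.+ ∑[ j < n ] (f (suc j) ℚ.* δ j i)
    ≡⟨ cong₂ ℚ._+_ (ℚ.*-zeroʳ (f zero)) (sum-δ (f ∘ suc) i) ⟩
  0ℚ ℚ.+ f (suc i)                                ≡⟨ ℚ.+-identityˡ _ ⟩
  f (suc i)                                       ∎

δ-sym : ∀ {n} (i j : Fin n) → δ i j ≡ δ j i
δ-sym zero    zero    = refl
δ-sym zero    (suc j) = refl
δ-sym (suc i) zero    = refl
δ-sym (suc i) (suc j) = δ-sym i j

sum-δˡ : ∀ {n} (f : Vector ℚ n) i → (∑[ j < n ] (δ i j ℚ.* f j)) ≡ f i
sum-δˡ f i = trans (sum-cong-≗ λ j → trans (cong (ℚ._* f j) (δ-sym i j)) (ℚ.*-comm (δ j i) (f j)))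
  (sum-δ f i)

sum-linear : ∀ {n} s (f g : Vector ℚ n) → (∑[ j < n ] (s ℚ.* f j ℚ.+ g j)) ≡ s ℚ.* sum f ℚ.+ sum g
sum-linear s f g = trans (∑-distrib-+ (λ j → s ℚ.* f j) g)
  (cong (ℚ._+ sum g) (sym (*-distribˡ-sum s f)))

module Action {n : ℕ} (A : Matrix n) where

  infixr 8 A·_

  A·_ : Vector ℚ n → Vector ℚ n
  (A· x) i = ∑[ j < n ] (A i j ℚ.* x j)

  -- This is p(A)x, computed without matrix powers: the vector is multiplied by `A` as each
  -- coefficient is consumed.
  act : Poly → Vector ℚ n → Vector ℚ n
  act []      x i = 0ℚ
  act (a ∷ p) x i = a ℚ.* x i ℚ.+ act p (A· x) i

  ·-cong : ∀ {x y} → x ≗ y → A· x ≗ A· y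
  ·-cong x≗y i = sum-cong-≗ λ j → cong (A i j ℚ.*_) (x≗y j)

  ·-linear : ∀ s x y → A· (λ i → s ℚ.* x i ℚ.+ y i) ≗ λ i → s ℚ.* (A· x) i ℚ.+ (A· y) i
  ·-linear s x y i = trans
    (sum-cong-≗ λ j → solve 4 (λ a s x y → (a :* (s :* x :+ y)) := (s :* (a :* x) :+ a :* y)) refl
      (A i j) s (x j) (y j))
    (sum-linear s (λ j → A i j ℚ.* x j) (λ j → A i j ℚ.* y j))

  act-cong : ∀ p {x y} → x ≗ y → act p x ≗ act p y
  act-cong []      x≗y i = refl
  act-cong (a ∷ p) x≗y i = cong₂ ℚ._+_ (cong (a ℚ.*_) (x≗y i)) (act-cong p (·-cong x≗y) i)

  act-linear : ∀ p s x y → act p (λ i → s ℚ.* x i ℚ.+ y i) ≗ λ i → s ℚ.* act p x i ℚ.+ act p y i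
  act-linear []      s x y i = sym (trans (ℚ.+-identityʳ _) (ℚ.*-zeroʳ s))
  act-linear (a ∷ p) s x y i = begin
    a ℚ.* (s ℚ.* x i ℚ.+ y i) ℚ.+ act p (A· (λ i → s ℚ.* x i ℚ.+ y i)) i
      ≡⟨ cong (a ℚ.* (s ℚ.* x i ℚ.+ y i) ℚ.+_)
           (trans (act-cong p (·-linear s x y) i) (act-linear p s (A· x) (A· y) i)) ⟩
    a ℚ.* (s ℚ.* x i ℚ.+ y i) ℚ.+ (s ℚ.* u ℚ.+ v)
      ≡⟨ solve 6 (λ a s x y u v → (a :* (s :* x :+ y) :+ (s :* u :+ v)) :=
           (s :* (a :* x :+ u) :+ (a :* y :+ v))) refl a s (x i) (y i) u v ⟩
    s ℚ.* (a ℚ.* x i ℚ.+ u) ℚ.+ (a ℚ.* y i ℚ.+ v) ∎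
    where
    u = act p (A· x) i
    v = act p (A· y) i

  act-sum : ∀ p {m} (x : Fin m → Vector ℚ n) i →
    act p (λ j → ∑[ k < m ] x k j) i ≡ ∑[ k < m ] act p (x k) i
  act-zero : ∀ p {x} → (∀ i → x i ≡ 0ℚ) → ∀ i → act p x i ≡ 0ℚ

  act-zero []      x≗0 i = refl
  act-zero (a ∷ p) x≗0 i = begin
    a ℚ.* _ ℚ.+ act p _ i ≡⟨ cong₂ ℚ._+_ (trans (cong (a ℚ.*_) (x≗0 i)) (ℚ.*-zeroʳ a))
                              (act-zero p (λ i → Detℚ.sum-zero λ j → trans
                                (cong (A i j ℚ.*_) (x≗0 j)) (ℚ.*-zeroʳ (A i j))) i) ⟩
    0ℚ ∎

  act-sum p {zero}  x i = act-zero p (λ _ → refl) i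
  act-sum p {suc m} x i = begin
    act p (λ j → x zero j ℚ.+ sum (λ k → x (suc k) j)) i
      ≡⟨ act-cong p (λ j → cong (ℚ._+ sum (λ k → x (suc k) j)) (sym (ℚ.*-identityˡ (x zero j)))) i ⟩
    act p (λ j → 1ℚ ℚ.* x zero j ℚ.+ sum (λ k → x (suc k) j)) i
      ≡⟨ act-linear p 1ℚ (x zero) (λ j → sum (λ k → x (suc k) j)) i ⟩
    1ℚ ℚ.* act p (x zero) i ℚ.+ act p (λ j → sum (λ k → x (suc k) j)) i
      ≡⟨ cong₂ ℚ._+_ (ℚ.*-identityˡ (act p (x zero) i)) (act-sum p (x ∘ suc) i) ⟩
    act p (x zero) i ℚ.+ sum (λ k → act p (x (suc k)) i) ∎

  act-+ : ∀ p q x → act (p +ₚ q) x ≗ λ i → act p x i ℚ.+ act q x i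
  act-+ []      q       x i = sym (ℚ.+-identityˡ _)
  act-+ (a ∷ p) []      x i = sym (ℚ.+-identityʳ _)
  act-+ (a ∷ p) (b ∷ q) x i = begin
    (a ℚ.+ b) ℚ.* x i ℚ.+ act (p +ₚ q) (A· x) i
      ≡⟨ cong ((a ℚ.+ b) ℚ.* x i ℚ.+_) (act-+ p q (A· x) i) ⟩
    (a ℚ.+ b) ℚ.* x i ℚ.+ (u ℚ.+ v)
      ≡⟨ solve 5 (λ a b x u v → ((a :+ b) :* x :+ (u :+ v)) := ((a :* x :+ u) :+ (b :* x :+ v)))
           refl a b (x i) u v ⟩
    (a ℚ.* x i ℚ.+ u) ℚ.+ (b ℚ.* x i ℚ.+ v)        ∎
    where
    u = act p (A· x) i
    v = act q (A· x) i

  act-scale : ∀ a p x → act (scale a p) x ≗ λ i → a ℚ.* act p x i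
  act-scale a []      x i = sym (ℚ.*-zeroʳ a)
  act-scale a (b ∷ p) x i = begin
    a ℚ.* b ℚ.* x i ℚ.+ act (scale a p) (A· x) i
      ≡⟨ cong (a ℚ.* b ℚ.* x i ℚ.+_) (act-scale a p (A· x) i) ⟩
    a ℚ.* b ℚ.* x i ℚ.+ a ℚ.* u
      ≡⟨ solve 4 (λ a b x u → (a :* b :* x :+ a :* u) := (a :* (b :* x :+ u))) refl a b (x i) u ⟩
    a ℚ.* (b ℚ.* x i ℚ.+ u)                        ∎
    where u = act p (A· x) i

  act-neg : ∀ p x → act (-ₚ p) x ≗ λ i → ℚ.- act p x i
  act-neg []      x i = refl
  act-neg (b ∷ p) x i = begin
    (ℚ.- b) ℚ.* x i ℚ.+ act (-ₚ p) (A· x) i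
      ≡⟨ cong ((ℚ.- b) ℚ.* x i ℚ.+_) (act-neg p (A· x) i) ⟩
    (ℚ.- b) ℚ.* x i ℚ.+ ℚ.- u
      ≡⟨ solve 3 (λ b x u → ((:- b) :* x :+ (:- u)) := (:- (b :* x :+ u))) refl b (x i) u ⟩
    ℚ.- (b ℚ.* x i ℚ.+ u)                          ∎
    where u = act p (A· x) i

  act-≈[] : ∀ p x → p ≈ₚ [] → ∀ i → act p x i ≡ 0ℚ
  act-≈[] []      x p≈0 i = refl
  act-≈[] (a ∷ p) x p≈0 i = cong₂ ℚ._+_
    (trans (cong (ℚ._* x i) (p≈0 zero)) (ℚ.*-zeroˡ (x i)))
    (act-≈[] p (A· x) (p≈0 ∘ suc) i)

  act-≈ : ∀ p q x → p ≈ₚ q → act p x ≗ act q x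
  act-≈ []      q       x p≈q i = sym (act-≈[] q x (sym ∘ p≈q) i)
  act-≈ (a ∷ p) []      x p≈q i = act-≈[] (a ∷ p) x p≈q i
  act-≈ (a ∷ p) (b ∷ q) x p≈q i = cong₂ ℚ._+_ (cong (ℚ._* x i) (p≈q zero))
    (act-≈ p q (A· x) (p≈q ∘ suc) i)

  act-· : ∀ p x → act p (A· x) ≗ A· act p x
  act-· []      x i = sym (Detℚ.sum-zero λ j → ℚ.*-zeroʳ (A i j))
  act-· (a ∷ p) x i = begin
    a ℚ.* (A· x) i ℚ.+ act p (A· (A· x)) i    ≡⟨ cong (a ℚ.* (A· x) i ℚ.+_) (act-· p (A· x) i) ⟩
    a ℚ.* (A· x) i ℚ.+ (A· act p (A· x)) i    ≡⟨ ·-linear a x (act p (A· x)) i ⟨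
    (A· act (a ∷ p) x) i                      ∎

  act-* : ∀ p q x → act (p *ₚ q) x ≗ act p (act q x)
  act-* []      q x i = refl
  act-* (a ∷ p) q x i = begin
    act (scale a q +ₚ (0ℚ ∷ p *ₚ q)) x i
      ≡⟨ act-+ (scale a q) (0ℚ ∷ p *ₚ q) x i ⟩
    act (scale a q) x i ℚ.+ (0ℚ ℚ.* x i ℚ.+ act (p *ₚ q) (A· x) i)
      ≡⟨ cong₂ ℚ._+_ (act-scale a q x i)
           (trans (cong (ℚ._+ act (p *ₚ q) (A· x) i) (ℚ.*-zeroˡ (x i))) (ℚ.+-identityˡ _)) ⟩
    a ℚ.* act q x i ℚ.+ act (p *ₚ q) (A· x) i
      ≡⟨ cong (a ℚ.* act q x i ℚ.+_) (trans (act-* p q (A· x) i) (act-cong p (act-· q x) i)) ⟩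
    a ℚ.* act q x i ℚ.+ act p (A· act q x) i ∎

  act-sumₚ : ∀ {m} (p : Fin m → Poly) x i → act (sumₚ p) x i ≡ ∑[ k < m ] act (p k) x i
  act-sumₚ {zero}  p x i = refl
  act-sumₚ {suc m} p x i = trans (act-+ (p zero) _ x i)
    (cong (act (p zero) x i ℚ.+_) (act-sumₚ (p ∘ suc) x i))

  act-zI-A : ∀ i j x l → act ((zI- A) i j) x l ≡ δ i j ℚ.* (A· x) l ℚ.+ ℚ.- (A i j ℚ.* x l)
  act-zI-A i j x l with does (i Fin.≟ j)
  ... | true  = solve 3 (λ a x u → ((con 0ℚ :+ :- a) :* x :+ (con 1ℚ :* u :+ con 0ℚ)) :=
    (con 1ℚ :* u :+ :- (a :* x))) refl (A i j) (x l) ((A· x) l)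
  ... | false = solve 3 (λ a x u → ((:- a) :* x :+ con 0ℚ) := (con 0ℚ :* u :+ :- (a :* x))) refl
    (A i j) (x l) ((A· x) l)

  -- Entry (i, j) of zI - A, evaluated at A, is δ i j A - A i j I. Applied to the basis vectors and
  -- summed over i, it gives A e_j minus column j of A.
  columns-vanish : ∀ j l → (∑[ i < n ] act ((zI- A) i j) (δ i) l) ≡ 0ℚ
  columns-vanish j l = begin
    ∑[ i < n ] act ((zI- A) i j) (δ i) l
      ≡⟨ sum-cong-≗ (λ i → trans (act-zI-A i j (δ i) l) (cong₂ ℚ._+_
           (trans (ℚ.*-comm (δ i j) _) (cong (ℚ._* δ i j)
             (trans (sum-cong-≗ λ k → cong (A l k ℚ.*_) (δ-sym i k)) (sum-δ (A l) i))))
           (sym (-1*x≈-x (A i j ℚ.* δ i l))))) ⟩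
    ∑[ i < n ] (A l i ℚ.* δ i j ℚ.+ ℚ.- 1ℚ ℚ.* (A i j ℚ.* δ i l))
      ≡⟨ ∑-distrib-+ (λ i → A l i ℚ.* δ i j) (λ i → ℚ.- 1ℚ ℚ.* (A i j ℚ.* δ i l)) ⟩
    (∑[ i < n ] (A l i ℚ.* δ i j)) ℚ.+ ∑[ i < n ] (ℚ.- 1ℚ ℚ.* (A i j ℚ.* δ i l))
      ≡⟨ cong₂ ℚ._+_ (sum-δ (A l) j)
           (trans (sym (*-distribˡ-sum (ℚ.- 1ℚ) (λ i → A i j ℚ.* δ i l)))
             (cong (ℚ.- 1ℚ ℚ.*_) (sum-δ (λ i → A i j) l))) ⟩
    A l j ℚ.+ ℚ.- 1ℚ ℚ.* A l j
      ≡⟨ solve 1 (λ a → (a :+ con (ℚ.- 1ℚ) :* a) := con 0ℚ) refl (A l j) ⟩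
    0ℚ ∎

  -- The determinant trick. By the adjugate identity over ℚ[z], P(A)e_k is the double sum over i and
  -- j of (zI - A)_ij C_kj evaluated at A and applied to e_i; for each fixed j, the sum over i is
  -- C_kj(A) applied to a vanishing vector.
  cayley-hamilton : ∀ x l → act (det ℚ[z] n (zI- A)) x l ≡ 0ℚ
  cayley-hamilton x l = begin
    act P x l
      ≡⟨ Detℚ.linear-functional (λ y → act P y l) (λ y≗z → act-cong P y≗z l)
           (λ s y z → act-linear P s y z l) x ⟩
    ∑[ k < n ] (x k ℚ.* act P (δ k) l)
      ≡⟨ Detℚ.sum-zero (λ k → trans (cong (x k ℚ.*_) (basis k)) (ℚ.*-zeroʳ (x k))) ⟩
    0ℚ                                  ∎
    where
    P : Poly
    P = det ℚ[z] n (zI- A)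
    C : Fin n → Fin n → Poly
    C = Detₚ.cofactor (zI- A)
    pick : ∀ i k → act (if does (i Fin.≟ k) then P else []) (δ i) l ≡ act P (δ i) l ℚ.* δ i k
    pick i k with does (i Fin.≟ k)
    ... | true  = sym (ℚ.*-identityʳ _)
    ... | false = sym (ℚ.*-zeroʳ (act P (δ i) l))
    basis : ∀ k → act P (δ k) l ≡ 0ℚ
    basis k = begin
      act P (δ k) l
        ≡⟨ sum-δ (λ i → act P (δ i) l) k ⟨
      ∑[ i < n ] (act P (δ i) l ℚ.* δ i k)
        ≡⟨ sum-cong-≗ (λ i → sym (pick i k)) ⟩
      ∑[ i < n ] act (if does (i Fin.≟ k) then P else []) (δ i) l
        ≡⟨ sum-cong-≗ (λ i → act-≈ (sumₚ λ j → (zI- A) i j *ₚ C k j)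
             (if does (i Fin.≟ k) then P else []) (δ i) (Detₚ.adjugate-identity (zI- A) i k) l) ⟨
      ∑[ i < n ] act (sumₚ λ j → (zI- A) i j *ₚ C k j) (δ i) l
        ≡⟨ sum-cong-≗ (λ i → act-sumₚ (λ j → (zI- A) i j *ₚ C k j) (δ i) l) ⟩
      ∑[ i < n ] ∑[ j < n ] act ((zI- A) i j *ₚ C k j) (δ i) l
        -- The cofactor, which depends on `j` but not on `i`, is moved outside, so that
        -- `columns-vanish` meets the inner sum after the exchange.
        ≡⟨ sum-cong-≗ (λ i → sum-cong-≗ λ j → trans
             (act-≈ ((zI- A) i j *ₚ C k j) (C k j *ₚ (zI- A) i j) (δ i)
               (*ₚ-comm ((zI- A) i j) (C k j)) l)
             (act-* (C k j) ((zI- A) i j) (δ i) l)) ⟩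
      ∑[ i < n ] ∑[ j < n ] act (C k j) (act ((zI- A) i j) (δ i)) l
        ≡⟨ ∑-comm (λ i j → act (C k j) (act ((zI- A) i j) (δ i)) l) ⟩
      ∑[ j < n ] ∑[ i < n ] act (C k j) (act ((zI- A) i j) (δ i)) l
        ≡⟨ sum-cong-≗ (λ j → sym (act-sum (C k j) (λ i → act ((zI- A) i j) (δ i)) l)) ⟩
      ∑[ j < n ] act (C k j) (λ m → ∑[ i < n ] act ((zI- A) i j) (δ i) m) l
        ≡⟨ Detℚ.sum-zero (λ j → act-zero (C k j) (columns-vanish j) l) ⟩
      0ℚ ∎

-- Degrees

x≢0∧xy≡0⇒y≡0 : ∀ {x y} → x ≢ 0ℚ → x ℚ.* y ≡ 0ℚ → y ≡ 0ℚ
x≢0∧xy≡0⇒y≡0 {x} {y} x≢0 xy≡0 = begin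
  y                      ≡⟨ ℚ.*-identityˡ y ⟨
  1ℚ ℚ.* y               ≡⟨ cong (ℚ._* y) (ℚ.*-inverseˡ x) ⟨
  ℚ.1/ x ℚ.* x ℚ.* y     ≡⟨ ℚ.*-assoc (ℚ.1/ x) x y ⟩
  ℚ.1/ x ℚ.* (x ℚ.* y)   ≡⟨ cong (ℚ.1/ x ℚ.*_) xy≡0 ⟩
  ℚ.1/ x ℚ.* 0ℚ          ≡⟨ ℚ.*-zeroʳ (ℚ.1/ x) ⟩
  0ℚ                     ∎
  where instance _ = ℚ.≢-nonZero x≢0

-- A bound instead of a degree: it covers the zero polynomial and is insensitive to trailing zeros.
Deg< : Poly → ℕ → Set
Deg< p d = ∀ k → d ℕ.≤ k → coeff p k ≡ 0ℚ

Deg<-length : ∀ p → Deg< p (List.length p)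
Deg<-length []      k       _         = refl
Deg<-length (a ∷ p) (suc k) (s≤s l≤k) = Deg<-length p k l≤k

-- The true degree is found by testing coefficients against zero, downwards from the bound.
leading : ∀ p m → Deg< p m → (p ≈ₚ []) ⊎ (∃[ d ] (d ℕ.< m × coeff p d ≢ 0ℚ × Deg< p (suc d)))
leading p zero    deg = inj₁ (λ k → deg k z≤n)
leading p (suc m) deg with coeff p m ℚ.≟ 0ℚ
... | no  pₘ≢0 = inj₂ (m , ℕ.≤-refl , pₘ≢0 , deg)
... | yes pₘ≡0 with leading p m deg′
  where
  deg′ : Deg< p m
  deg′ k m≤k with ℕ.m≤n⇒m<n∨m≡n m≤k
  ... | inj₁ m<k  = deg k m<k
  ... | inj₂ refl = pₘ≡0
... | inj₁ p≈0                  = inj₁ p≈0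
... | inj₂ (d , d<m , p_d , dg) = inj₂ (d , ℕ.m≤n⇒m≤1+n d<m , p_d , dg)

Deg<-* : ∀ p q a b → Deg< p (suc a) → Deg< q (suc b) → Deg< (p *ₚ q) (suc (a ℕ.+ b))
coeff-*-top : ∀ p q a b → Deg< p (suc a) → Deg< q (suc b) →
  coeff (p *ₚ q) (a ℕ.+ b) ≡ coeff p a ℚ.* coeff q b

tail-vanishes : ∀ c p q → Deg< (c ∷ p) 1 → ∀ k → coeff (0ℚ ∷ p *ₚ q) k ≡ 0ℚ
tail-vanishes c p q deg zero    = refl
tail-vanishes c p q deg (suc k) = *ₚ-cong {p} {[]} {q} {q} (λ k → deg (suc k) (s≤s z≤n))
  (λ _ → refl) k

Deg<-* []      q a       b dp dq k       _ = refl
Deg<-* (c ∷ p) q zero    b dp dq k       b<k = begin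
  coeff ((c ∷ p) *ₚ q) k                          ≡⟨ coeff-∷-* c p q k ⟩
  c ℚ.* coeff q k ℚ.+ coeff (0ℚ ∷ p *ₚ q) k
    ≡⟨ cong₂ (λ u v → c ℚ.* u ℚ.+ v) (dq k b<k) (tail-vanishes c p q dp k) ⟩
  c ℚ.* 0ℚ ℚ.+ 0ℚ                                 ≡⟨ cong (ℚ._+ 0ℚ) (ℚ.*-zeroʳ c) ⟩
  0ℚ                                              ∎
Deg<-* (c ∷ p) q (suc a) b dp dq (suc k) (s≤s a+b<k) = begin
  coeff ((c ∷ p) *ₚ q) (suc k)                    ≡⟨ coeff-∷-* c p q (suc k) ⟩
  c ℚ.* coeff q (suc k) ℚ.+ coeff (p *ₚ q) k      ≡⟨ cong₂ (λ u v → c ℚ.* u ℚ.+ v)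
                                                       (dq (suc k) (s≤s (ℕ.≤-trans (ℕ.m≤n+m b a)
                                                         (ℕ.<⇒≤ a+b<k))))
                                                       (Deg<-* p q a b (λ k le → dp (suc k)
                                                         (s≤s le)) dq k a+b<k) ⟩
  c ℚ.* 0ℚ ℚ.+ 0ℚ                                 ≡⟨ cong (ℚ._+ 0ℚ) (ℚ.*-zeroʳ c) ⟩
  0ℚ                                              ∎

coeff-*-top []      q a       b dp dq = sym (ℚ.*-zeroˡ (coeff q b))
coeff-*-top (c ∷ p) q zero    b dp dq = begin
  coeff ((c ∷ p) *ₚ q) b                          ≡⟨ coeff-∷-* c p q b ⟩
  c ℚ.* coeff q b ℚ.+ coeff (0ℚ ∷ p *ₚ q) b
    ≡⟨ cong (c ℚ.* coeff q b ℚ.+_) (tail-vanishes c p q dp b) ⟩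
  c ℚ.* coeff q b ℚ.+ 0ℚ                          ≡⟨ ℚ.+-identityʳ _ ⟩
  c ℚ.* coeff q b                                 ∎
coeff-*-top (c ∷ p) q (suc a) b dp dq = begin
  coeff ((c ∷ p) *ₚ q) (suc (a ℕ.+ b))            ≡⟨ coeff-∷-* c p q (suc (a ℕ.+ b)) ⟩
  c ℚ.* coeff q (suc (a ℕ.+ b)) ℚ.+ coeff (p *ₚ q) (a ℕ.+ b)
                                                  ≡⟨ cong₂ (λ u v → c ℚ.* u ℚ.+ v)
                                                       (dq (suc (a ℕ.+ b)) (s≤s (ℕ.m≤n+m b a)))
                                                       (coeff-*-top p q a b (λ k le → dp (suc k)
                                                         (s≤s le)) dq) ⟩
  c ℚ.* 0ℚ ℚ.+ coeff p a ℚ.* coeff q b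
    ≡⟨ cong (ℚ._+ coeff p a ℚ.* coeff q b) (ℚ.*-zeroʳ c) ⟩
  0ℚ ℚ.+ coeff p a ℚ.* coeff q b                  ≡⟨ ℚ.+-identityˡ _ ⟩
  coeff p a ℚ.* coeff q b                         ∎

coeff-sum : ∀ {m} (p : Fin m → Poly) k → coeff (sumₚ p) k ≡ ∑[ i < m ] coeff (p i) k
coeff-sum {zero}  p k = refl
coeff-sum {suc m} p k = trans (coeff-+ (p zero) _ k)
  (cong (coeff (p zero) k ℚ.+_) (coeff-sum (p ∘ suc) k))

private
  module ^ₚ = RawSemiringDefinitions
    (Semiring.rawSemiring (CommutativeRing.semiring Poly-commutativeRing))
  module ^ = RawSemiringDefinitions
    (Semiring.rawSemiring (CommutativeRing.semiring ℚ.+-*-commutativeRing))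

Deg<-sgn : ∀ e → Deg< ((-ₚ constant 1ℚ) ^ₚ.^ e) 1
Deg<-sgn zero    (suc k) _ = refl
Deg<-sgn (suc e) = Deg<-* (-ₚ constant 1ℚ) ((-ₚ constant 1ℚ) ^ₚ.^ e) 0 0 (λ { (suc k) _ → refl })
  (Deg<-sgn e)

coeff-sgn : ∀ e → coeff ((-ₚ constant 1ℚ) ^ₚ.^ e) 0 ≡ (ℚ.- 1ℚ) ^.^ e
coeff-sgn zero    = refl
coeff-sgn (suc e) = trans
  (coeff-*-top (-ₚ constant 1ℚ) ((-ₚ constant 1ℚ) ^ₚ.^ e) 0 0 (λ { (suc k) _ → refl }) (Deg<-sgn e))
  (cong ((ℚ.- 1ℚ) ℚ.*_) (coeff-sgn e))

Deg<-det : ∀ n (M : Fin n → Fin n → Poly) → (∀ i j → Deg< (M i j) 2) → Deg< (det ℚ[z] n M) (suc n)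
Deg<-det zero    M deg (suc k) _ = refl
Deg<-det (suc n) M deg k n<k = trans (coeff-sum t k) (Detℚ.sum-zero λ j →
  Deg<-* (Detₚ.sgn j) (M zero j *ₚ D j) 0 (suc n) (Deg<-sgn (toℕ j))
    (Deg<-* (M zero j) (D j) 1 n (deg zero j)
      (Deg<-det n (Detₚ.minor M j) λ i l → deg (suc i) (punchIn j l))) k n<k)
  where
  D t : Fin (suc n) → Poly
  D j = det ℚ[z] n (Detₚ.minor M j)
  t j = Detₚ.sgn j *ₚ (M zero j *ₚ D j)

-- For `zI- A` the matrix of linear coefficients is the identity, which makes the characteristic
-- polynomial monic.
coeff-det-top : ∀ n (M : Fin n → Fin n → Poly) → (∀ i j → Deg< (M i j) 2) →
  coeff (det ℚ[z] n M) n ≡ Detℚ.∣ (λ i j → coeff (M i j) 1) ∣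
coeff-det-top zero    M deg = refl
coeff-det-top (suc n) M deg = trans (coeff-sum t (suc n)) (sum-cong-≗ λ j → begin
  coeff (Detₚ.sgn j *ₚ (M zero j *ₚ D j)) (suc n)
    ≡⟨ coeff-*-top (Detₚ.sgn j) (M zero j *ₚ D j) 0 (suc n) (Deg<-sgn (toℕ j))
         (Deg<-* (M zero j) (D j) 1 n (deg zero j) (degD j)) ⟩
  coeff (Detₚ.sgn j) 0 ℚ.* coeff (M zero j *ₚ D j) (suc n)
    ≡⟨ cong₂ ℚ._*_ (coeff-sgn (toℕ j))
         (trans (coeff-*-top (M zero j) (D j) 1 n (deg zero j) (degD j))
         (cong (coeff (M zero j) 1 ℚ.*_)
           (coeff-det-top n (Detₚ.minor M j) λ i l → deg (suc i) (punchIn j l)))) ⟩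
  _ ∎)
  where
  D t : Fin (suc n) → Poly
  D j = det ℚ[z] n (Detₚ.minor M j)
  t j = Detₚ.sgn j *ₚ (M zero j *ₚ D j)
  degD : ∀ j → Deg< (D j) (suc n)
  degD j = Deg<-det n (Detₚ.minor M j) λ i l → deg (suc i) (punchIn j l)

Deg<-zI- : ∀ {n} (A : Matrix n) i j → Deg< ((zI- A) i j) 2
Deg<-zI- A i j (suc (suc k)) _ with does (i Fin.≟ j)
... | true  = refl
... | false = refl
Deg<-zI- A i j (suc zero) (s≤s ())

coeff-zI- : ∀ {n} (A : Matrix n) i j → coeff ((zI- A) i j) 1 ≡ δ i j
coeff-zI- A i j with does (i Fin.≟ j)
... | true  = refl
... | false = refl

charPoly-degree : ∀ {n} (A : Matrix n) → Deg< (det ℚ[z] n (zI- A)) (suc n)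
charPoly-degree {n} A = Deg<-det n (zI- A) (Deg<-zI- A)

charPoly-monic : ∀ {n} (A : Matrix n) → coeff (det ℚ[z] n (zI- A)) n ≡ 1ℚ
charPoly-monic {n} A = begin
  coeff (det ℚ[z] n (zI- A)) n                  ≡⟨ coeff-det-top n (zI- A) (Deg<-zI- A) ⟩
  Detℚ.∣ (λ i j → coeff ((zI- A) i j) 1) ∣      ≡⟨ Detℚ.det-cong (coeff-zI- A) ⟩
  Detℚ.∣ δ {n} ∣                                ≡⟨ Detℚ.det-identity n ⟩
  1ℚ                                            ∎

-- From p = q g + r one gets a + z p = (z q) g + (a + z r). The new remainder has degree at most
-- `d`, so subtracting one multiple `c` of `g` clears its coefficient at `d`.
division : ∀ g d → coeff g d ≢ 0ℚ → Deg< g (suc d) →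
  ∀ p → ∃[ q ] ∃[ r ] ((p ≈ₚ (q *ₚ g +ₚ r)) × Deg< r d)
division g d g_d≢0 deg []      = [] , [] , (λ _ → refl) , (λ _ _ → refl)
division g d g_d≢0 deg (a ∷ p) with division g d g_d≢0 deg p
... | q , r , p≈ , degr = c ∷ q , (a ∷ r) +ₚ (-ₚ scale c g) , p≈′ , degr′
  where
  instance _ = ℚ.≢-nonZero g_d≢0
  c : ℚ
  c = coeff (a ∷ r) d ℚ.* ℚ.1/ coeff g d
  coeff-r′ : ∀ k → coeff ((a ∷ r) +ₚ (-ₚ scale c g)) k ≡ coeff (a ∷ r) k ℚ.+ ℚ.- (c ℚ.* coeff g k)
  coeff-r′ k = trans (coeff-+ (a ∷ r) (-ₚ scale c g) k)
    (cong (coeff (a ∷ r) k ℚ.+_) (trans (coeff-neg (scale c g) k)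
      (cong (ℚ.-_) (coeff-scale c g k))))
  shifted : ∀ k → coeff (a ∷ p) k ≡ coeff (0ℚ ∷ q *ₚ g) k ℚ.+ coeff (a ∷ r) k
  shifted zero    = sym (ℚ.+-identityˡ a)
  shifted (suc k) = trans (p≈ k) (coeff-+ (q *ₚ g) r k)
  p≈′ : (a ∷ p) ≈ₚ ((c ∷ q) *ₚ g +ₚ ((a ∷ r) +ₚ (-ₚ scale c g)))
  p≈′ k = begin
    coeff (a ∷ p) k
      ≡⟨ shifted k ⟩
    x ℚ.+ y
      ≡⟨ solve 4 (λ x y c g → (x :+ y) := ((c :* g :+ x) :+ (y :+ :- (c :* g)))) refl x y c
           (coeff g k) ⟩
    (c ℚ.* coeff g k ℚ.+ x) ℚ.+ (y ℚ.+ ℚ.- (c ℚ.* coeff g k))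
      ≡⟨ cong₂ ℚ._+_ (coeff-∷-* c q g k) (coeff-r′ k) ⟨
    coeff ((c ∷ q) *ₚ g) k ℚ.+ coeff ((a ∷ r) +ₚ (-ₚ scale c g)) k
      ≡⟨ coeff-+ ((c ∷ q) *ₚ g) _ k ⟨
    coeff ((c ∷ q) *ₚ g +ₚ ((a ∷ r) +ₚ (-ₚ scale c g))) k ∎
    where
    x = coeff (0ℚ ∷ q *ₚ g) k
    y = coeff (a ∷ r) k
  deg-a∷r : ∀ k → d ℕ.< k → coeff (a ∷ r) k ≡ 0ℚ
  deg-a∷r (suc k) (s≤s d≤k) = degr k d≤k
  degr′ : Deg< ((a ∷ r) +ₚ (-ₚ scale c g)) d
  degr′ k d≤k with ℕ.m≤n⇒m<n∨m≡n d≤k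
  ... | inj₁ d<k  = begin
    _                                           ≡⟨ coeff-r′ k ⟩
    coeff (a ∷ r) k ℚ.+ ℚ.- (c ℚ.* coeff g k)
      ≡⟨ cong₂ (λ u v → u ℚ.+ ℚ.- (c ℚ.* v)) (deg-a∷r k d<k) (deg k d<k) ⟩
    0ℚ ℚ.+ ℚ.- (c ℚ.* 0ℚ)                       ≡⟨ cong (λ u → 0ℚ ℚ.+ ℚ.- u) (ℚ.*-zeroʳ c) ⟩
    0ℚ                                          ∎
  ... | inj₂ refl = begin
    _                                           ≡⟨ coeff-r′ k ⟩
    y ℚ.+ ℚ.- (y ℚ.* ℚ.1/ coeff g k ℚ.* coeff g k)
      ≡⟨ cong (λ u → y ℚ.+ ℚ.- u) (trans (ℚ.*-assoc y (ℚ.1/ coeff g k) (coeff g k))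
           (trans (cong (y ℚ.*_) (ℚ.*-inverseˡ (coeff g k))) (ℚ.*-identityʳ y))) ⟩
    y ℚ.+ ℚ.- y                                 ≡⟨ ℚ.+-inverseʳ y ⟩
    0ℚ                                          ∎
    where y = coeff (a ∷ r) k

-- Cyclic vectors

-- Gaussian elimination on coordinate 0. Without a pivot, vector 0 gets coefficient 0 and the others
-- lie in one dimension less. With pivot `p`, coordinate 0 is cleared from the other vectors and a
-- relation among the results is lifted.
dependent : ∀ n (v : Fin (suc n) → Vector ℚ n) →
  Σ[ c ∈ Vector ℚ (suc n) ] ((∃[ i ] c i ≢ 0ℚ) × ∀ j → (∑[ i < suc n ] (c i ℚ.* v i j)) ≡ 0ℚ)
dependent zero    v = (λ _ → 1ℚ) , (zero , ℚ.1≢0) , λ ()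
dependent (suc n) v with Fin.any? (λ i → ¬? (v i zero ℚ.≟ 0ℚ))
... | no all-zero with dependent n (λ i j → v (suc i) (suc j))
...   | c , (i , c_i≢0) , eq = insertAt c zero 0ℚ , (suc i , c_i≢0) , λ j → begin
    0ℚ ℚ.* v zero j ℚ.+ ∑[ i < suc n ] (c i ℚ.* v (suc i) j)
      ≡⟨ cong₂ ℚ._+_ (ℚ.*-zeroˡ (v zero j)) (vanish j) ⟩
    0ℚ                                                        ∎
  where
  vanish : ∀ j → (∑[ i < suc n ] (c i ℚ.* v (suc i) j)) ≡ 0ℚ
  vanish zero    = Detℚ.sum-zero λ i → trans
    (cong (c i ℚ.*_) (decidable-stable (v (suc i) zero ℚ.≟ 0ℚ) λ v≢0 → all-zero (suc i , v≢0)))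
      (ℚ.*-zeroʳ (c i))
  vanish (suc j) = eq j
dependent (suc n) v | yes (p , vₚ≢0)
  with dependent n (λ i j → v p zero ℚ.* v (punchIn p i) (suc j) ℚ.+ ℚ.-
    (v (punchIn p i) zero ℚ.* v p (suc j)))
... | c , (i , c_i≢0) , eq = c′ , (punchIn p i , c′≢0) , λ j → trans (eliminate j) (vanish j)
  where
  s : ℚ
  s = ∑[ i < suc n ] (c i ℚ.* v (punchIn p i) zero)
  -- Collecting terms in the sum of `c i` times `w i`, the pivot vector occurs with coefficient -s,
  -- and every other vector with `c i` scaled by the pivot entry. That entry is nonzero, so the
  -- relation stays nontrivial.
  c′ : Vector ℚ (suc (suc n))
  c′ = insertAt (λ i → v p zero ℚ.* c i) p (ℚ.- s)
  c′-punchIn : ∀ i → c′ (punchIn p i) ≡ v p zero ℚ.* c i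
  c′-punchIn = Vector.insertAt-punchIn (λ i → v p zero ℚ.* c i) p (ℚ.- s)
  c′≢0 : c′ (punchIn p i) ≢ 0ℚ
  c′≢0 eq₀ = c_i≢0 (x≢0∧xy≡0⇒y≡0 vₚ≢0 (trans (sym (c′-punchIn i)) eq₀))
  w : Fin (suc n) → Vector ℚ (suc n)
  w i j = v p zero ℚ.* v (punchIn p i) j ℚ.+ ℚ.- (v (punchIn p i) zero ℚ.* v p j)
  eliminate : ∀ j → (∑[ i < suc (suc n) ] (c′ i ℚ.* v i j)) ≡ ∑[ i < suc n ] (c i ℚ.* w i j)
  eliminate j = begin
    ∑[ i < suc (suc n) ] (c′ i ℚ.* v i j)
      ≡⟨ sum-remove {i = p} (λ i → c′ i ℚ.* v i j) ⟩
    c′ p ℚ.* v p j ℚ.+ ∑[ i < suc n ] (c′ (punchIn p i) ℚ.* v (punchIn p i) j)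
      ≡⟨ cong₂ ℚ._+_
           (trans (cong (ℚ._* v p j) (Vector.insertAt-lookup (λ i → v p zero ℚ.* c i) p (ℚ.- s)))
                  (solve 2 (λ s y → (:- s :* y) := (:- y :* s)) refl s (v p j)))
           (sum-cong-≗ λ i → cong (ℚ._* v (punchIn p i) j) (c′-punchIn i)) ⟩
    (ℚ.- v p j) ℚ.* s ℚ.+ ∑[ i < suc n ] (v p zero ℚ.* c i ℚ.* v (punchIn p i) j)
      ≡⟨ sum-linear (ℚ.- v p j) (λ i → c i ℚ.* v (punchIn p i) zero)
           (λ i → v p zero ℚ.* c i ℚ.* v (punchIn p i) j) ⟨
    ∑[ i < suc n ] ((ℚ.- v p j) ℚ.* (c i ℚ.* v (punchIn p i) zero) ℚ.+ v p zero ℚ.* c i ℚ.* v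
      (punchIn p i) j)
      ≡⟨ sum-cong-≗ (λ i → solve 5 (λ y c x z u → ((:- y) :* (c :* x) :+ z :* c :* u) :=
           (c :* (z :* u :+ :- (x :* y)))) refl
           (v p j) (c i) (v (punchIn p i) zero) (v p zero) (v (punchIn p i) j)) ⟩
    ∑[ i < suc n ] (c i ℚ.* w i j) ∎
  vanish : ∀ j → (∑[ i < suc n ] (c i ℚ.* w i j)) ≡ 0ℚ
  vanish zero    = Detℚ.sum-zero λ i → solve 3
    (λ c x z → (c :* (z :* x :+ :- (x :* z))) := con 0ℚ) refl (c i) (v (punchIn p i) zero)
      (v p zero)
  vanish (suc j) = eq j

-- The positive definite form on ℚⁿ

⟨_,_⟩ : ∀ {n} → Vector ℚ n → Vector ℚ n → ℚ
⟨_,_⟩ {n} x y = ∑[ i < n ] (x i ℚ.* y i)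

0≤x*x : ∀ x → 0ℚ ℚ.≤ x ℚ.* x
0≤x*x x with ℚ.≤-total 0ℚ x
... | inj₁ 0≤x = ℚ.nonNegative⁻¹
  (x ℚ.* x) {{ℚ.nonNeg*nonNeg⇒nonNeg x {{ℚ.nonNegative 0≤x}} x {{ℚ.nonNegative 0≤x}}}}
... | inj₂ x≤0 = ℚ.nonNegative⁻¹
  (x ℚ.* x) {{ℚ.nonPos*nonPos⇒nonPos x {{ℚ.nonPositive x≤0}} x {{ℚ.nonPositive x≤0}}}}

sum-nonNeg : ∀ {n} (f : Vector ℚ n) → (∀ i → 0ℚ ℚ.≤ f i) → 0ℚ ℚ.≤ sum f
sum-nonNeg {zero}  f 0≤f = ℚ.≤-refl
sum-nonNeg {suc n} f 0≤f = ℚ.+-mono-≤ (0≤f zero) (sum-nonNeg (f ∘ suc) (0≤f ∘ suc))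

nonNeg-sum≡0 : ∀ {n} (f : Vector ℚ n) → (∀ i → 0ℚ ℚ.≤ f i) → sum f ≡ 0ℚ → ∀ i → f i ≡ 0ℚ
nonNeg-sum≡0 {suc n} f 0≤f eq = λ
  { zero    → f₀≡0
  ; (suc i) → nonNeg-sum≡0 (f ∘ suc) (0≤f ∘ suc)
    (trans (sym (ℚ.+-identityˡ _)) (trans (cong (ℚ._+ sum (f ∘ suc)) (sym f₀≡0)) eq)) i
  }
  where
  f₀≤0 : f zero ℚ.≤ 0ℚ
  f₀≤0 = subst (f zero ℚ.≤_) eq (subst (ℚ._≤ sum f) (ℚ.+-identityʳ (f zero))
    (ℚ.+-monoʳ-≤ (f zero) (sum-nonNeg (f ∘ suc) (0≤f ∘ suc))))
  f₀≡0 : f zero ≡ 0ℚ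
  f₀≡0 = ℚ.≤-antisym f₀≤0 (0≤f zero)

⟨x,x⟩≡0⇒x≗0 : ∀ {n} (x : Vector ℚ n) → ⟨ x , x ⟩ ≡ 0ℚ → ∀ i → x i ≡ 0ℚ
⟨x,x⟩≡0⇒x≗0 x eq i = decidable-stable (x i ℚ.≟ 0ℚ) λ xᵢ≢0 →
  xᵢ≢0 (x≢0∧xy≡0⇒y≡0 xᵢ≢0 (nonNeg-sum≡0 (λ i → x i ℚ.* x i) (λ i → 0≤x*x (x i)) eq i))

coeff-tabulate : ∀ {m} (c : Vector ℚ m) k → coeff (List.tabulate c) (toℕ k) ≡ c k
coeff-tabulate c zero    = refl
coeff-tabulate c (suc k) = coeff-tabulate (c ∘ suc) k

Deg<-tabulate : ∀ {m} (c : Vector ℚ m) → Deg< (List.tabulate c) m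
Deg<-tabulate c k m≤k = Deg<-length (List.tabulate c) k
  (subst (ℕ._≤ k) (sym (List.length-tabulate c)) m≤k)

-- Krylov vectors under an irreducible characteristic polynomial

module Krylov {n : ℕ} (A : Matrix n) where
  open Action A public

  pow : ℕ → Vector ℚ n → Vector ℚ n
  pow zero    x = x
  pow (suc k) x = pow k (A· x)

  act-tabulate : ∀ {m} (c : Vector ℚ m) x i → act (List.tabulate c) x i ≡ ∑[ k < m ]
    (c k ℚ.* pow (toℕ k) x i)
  act-tabulate {zero}  c x i = refl
  act-tabulate {suc m} c x i = cong (c zero ℚ.* x i ℚ.+_) (act-tabulate (c ∘ suc) (A· x) i)

  module _ (irreducible : IrreducibleOverℚ (det ℚ[z] n (zI- A))) where

    private
      P : Poly
      P = det ℚ[z] n (zI- A)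

    -- ℚ[z]/(P) is a field: dividing P by g leaves a remainder of smaller
    -- degree that still annihilates y, down to a proper divisor of P.

    annihilator : ∀ m d g → d ℕ.< m → d ℕ.< n → coeff g d ≢ 0ℚ → Deg< g (suc d) →
      ∀ y → (∀ i → act g y i ≡ 0ℚ) → ∀ i → y i ≡ 0ℚ
    -- `m` bounds `d` and carries the recursion: each remainder has smaller degree than `g`.
    annihilator (suc m) d g (s≤s d≤m) d<n g_d≢0 deg-g y gy≗0 with division g d g_d≢0 deg-g P
    ... | q , r , P≈ , deg-r = conclude (leading r d deg-r)
      where
      ry≗0 : ∀ i → act r y i ≡ 0ℚ
      ry≗0 i = begin
        act r y i                           ≡⟨ ℚ.+-identityˡ _ ⟨
        0ℚ ℚ.+ act r y i
          ≡⟨ cong (ℚ._+ act r y i) (trans (act-* q g y i) (act-zero q gy≗0 i)) ⟨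
        act (q *ₚ g) y i ℚ.+ act r y i      ≡⟨ act-+ (q *ₚ g) r y i ⟨
        act (q *ₚ g +ₚ r) y i               ≡⟨ act-≈ P (q *ₚ g +ₚ r) y P≈ i ⟨
        act P y i                           ≡⟨ cayley-hamilton y i ⟩
        0ℚ                                  ∎
      conclude : (r ≈ₚ []) ⊎ (∃[ e ] (e ℕ.< d × coeff r e ≢ 0ℚ × Deg< r (suc e))) → ∀ i → y i ≡ 0ℚ
      conclude (inj₂ (e , e<d , r_e≢0 , deg-r′)) =
        annihilator m e r (ℕ.≤-trans e<d d≤m) (ℕ.<-trans e<d d<n) r_e≢0 deg-r′ y ry≗0
      conclude (inj₁ r≈0) = [ (λ (h , hq≈1) → q-unit h hq≈1) , (λ (h , hg≈1) → g-unit h hg≈1) ]′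
        (RawSemiringDefinitions.Irreducible.split-∣1 irreducible {q} {g} P≈qg)
        where
        P≈qg : P ≈ₚ (q *ₚ g)
        P≈qg k = begin
          coeff P k                         ≡⟨ P≈ k ⟩
          coeff (q *ₚ g +ₚ r) k             ≡⟨ coeff-+ (q *ₚ g) r k ⟩
          coeff (q *ₚ g) k ℚ.+ coeff r k    ≡⟨ cong (coeff (q *ₚ g) k ℚ.+_) (r≈0 k) ⟩
          coeff (q *ₚ g) k ℚ.+ 0ℚ           ≡⟨ ℚ.+-identityʳ _ ⟩
          coeff (q *ₚ g) k                  ∎
        g-unit : ∀ h → (h *ₚ g) ≈ₚ constant 1ℚ → ∀ i → y i ≡ 0ℚ
        g-unit h hg≈1 i = begin
          y i
            ≡⟨ solve 1 (λ y → y := (con 1ℚ :* y :+ con 0ℚ)) refl (y i) ⟩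
          act (constant 1ℚ) y i             ≡⟨ act-≈ (h *ₚ g) (constant 1ℚ) y hg≈1 i ⟨
          act (h *ₚ g) y i                  ≡⟨ act-* h g y i ⟩
          act h (act g y) i                 ≡⟨ act-zero h gy≗0 i ⟩
          0ℚ                                ∎
        -- If `q` were a unit with inverse `h`, then g = h P. As `P` is monic of degree `n`, the
        -- leading coefficient of `h` would be the coefficient of `g` at `e + n`, which is 0 because
        -- `d < n`.
        q-unit : ∀ h → (h *ₚ q) ≈ₚ constant 1ℚ → ∀ i → y i ≡ 0ℚ
        q-unit h hq≈1 with leading h (List.length h) (Deg<-length h)
        ... | inj₁ h≈0 = contradiction
          (trans (sym (hq≈1 0)) (*ₚ-cong {h} {[]} {q} {q} h≈0 (λ _ → refl) 0)) ℚ.1≢0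
        ... | inj₂ (e , _ , h_e≢0 , deg-h) = contradiction
          (begin
            coeff h e                       ≡⟨ ℚ.*-identityʳ _ ⟨
            coeff h e ℚ.* 1ℚ                ≡⟨ cong (coeff h e ℚ.*_) (charPoly-monic A) ⟨
            coeff h e ℚ.* coeff P n         ≡⟨ coeff-*-top h P e n deg-h (charPoly-degree A) ⟨
            coeff (h *ₚ P) (e ℕ.+ n)        ≡⟨ g≈hP (e ℕ.+ n) ⟨
            coeff g (e ℕ.+ n)               ≡⟨ deg-g (e ℕ.+ n) (ℕ.≤-trans d<n (ℕ.m≤n+m n e)) ⟩
            0ℚ                              ∎)
          h_e≢0
          where
          g≈hP : g ≈ₚ (h *ₚ P)
          g≈hP k = begin
            coeff g k                       ≡⟨ *ₚ-identityˡ g k ⟨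
            coeff (constant 1ℚ *ₚ g) k
              ≡⟨ *ₚ-cong {h *ₚ q} {constant 1ℚ} {g} {g} hq≈1 (λ _ → refl) k ⟨
            coeff ((h *ₚ q) *ₚ g) k         ≡⟨ *ₚ-assoc h q g k ⟩
            coeff (h *ₚ (q *ₚ g)) k         ≡⟨ *ₚ-congˡ h P≈qg k ⟨
            coeff (h *ₚ P) k                ∎

    -- In terms of vectors: y, Ay, ..., Aⁿ⁻¹y are linearly independent.
    independent : ∀ g → Deg< g n → ∀ y → ¬ (∀ i → y i ≡ 0ℚ) → (∀ i → act g y i ≡ 0ℚ) → g ≈ₚ []
    independent g deg-g y y≢0 gy≗0 with leading g n deg-g
    ... | inj₁ g≈0                     = g≈0
    ... | inj₂ (d , d<n , g_d≢0 , dg)  = contradiction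
      (annihilator (suc d) d g ℕ.≤-refl d<n g_d≢0 dg y gy≗0) y≢0

    -- The n + 1 vectors x, y, Ay, ..., Aⁿ⁻¹y are dependent, and a relation not involving x would
    -- contradict `independent`.
    cyclic : ∀ y → ¬ (∀ i → y i ≡ 0ℚ) → ∀ x →
      ∃[ c ] ∃[ g ] (c ≢ 0ℚ × ∀ i → c ℚ.* x i ℚ.+ act g y i ≡ 0ℚ)
    cyclic y y≢0 x with dependent n (λ { zero → x ; (suc k) → pow (toℕ k) y })
    ... | c , (k , c_k≢0) , eq = c zero , g , c₀≢0 , relation
      where
      g : Poly
      g = List.tabulate (c ∘ suc)
      relation : ∀ i → c zero ℚ.* x i ℚ.+ act g y i ≡ 0ℚ
      relation i = trans (cong (c zero ℚ.* x i ℚ.+_) (act-tabulate (c ∘ suc) y i)) (eq i)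
      c₀≢0 : c zero ≢ 0ℚ
      c₀≢0 c₀≡0 = c_k≢0 (c≗0 k)
        where
        g≈0 : g ≈ₚ []
        g≈0 = independent g (Deg<-tabulate (c ∘ suc)) y y≢0 λ i → begin
          act g y i                         ≡⟨ ℚ.+-identityˡ _ ⟨
          0ℚ ℚ.+ act g y i
            ≡⟨ cong (ℚ._+ act g y i) (trans (cong (ℚ._* x i) c₀≡0) (ℚ.*-zeroˡ (x i))) ⟨
          c zero ℚ.* x i ℚ.+ act g y i      ≡⟨ relation i ⟩
          0ℚ                                ∎
        c≗0 : ∀ k → c k ≡ 0ℚ
        c≗0 zero    = c₀≡0
        c≗0 (suc k) = trans (sym (coeff-tabulate (c ∘ suc) k)) (g≈0 (toℕ k))

    -- Pairing the relation c x + g(A)y = 0 from `cyclic` with x leaves c ⟨x, x⟩ = 0, and the form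
    -- is positive definite.
    nondegenerate : ∀ x y → ¬ (∀ i → y i ≡ 0ℚ) → (∀ f → ⟨ x , act f y ⟩ ≡ 0ℚ) → ∀ i → x i ≡ 0ℚ
    nondegenerate x y y≢0 x⊥y with cyclic y y≢0 x
    ... | c , g , c≢0 , eq = ⟨x,x⟩≡0⇒x≗0 x (x≢0∧xy≡0⇒y≡0 c≢0 (begin
      c ℚ.* ⟨ x , x ⟩                         ≡⟨ ℚ.+-identityʳ _ ⟨
      c ℚ.* ⟨ x , x ⟩ ℚ.+ 0ℚ                  ≡⟨ cong (c ℚ.* ⟨ x , x ⟩ ℚ.+_) (x⊥y g) ⟨
      c ℚ.* ⟨ x , x ⟩ ℚ.+ ⟨ x , act g y ⟩
        ≡⟨ sum-linear c (λ i → x i ℚ.* x i) (λ i → x i ℚ.* act g y i) ⟨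
      sum (λ i → c ℚ.* (x i ℚ.* x i) ℚ.+ x i ℚ.* act g y i)
        ≡⟨ Detℚ.sum-zero (λ i → trans
             (solve 3 (λ c x u → (c :* (x :* x) :+ x :* u) := (x :* (c :* x :+ u))) refl c (x i)
               (act g y i))
             (trans (cong (x i ℚ.*_) (eq i)) (ℚ.*-zeroʳ (x i)))) ⟩
      0ℚ                                      ∎))

-- Graphs and their adjacency matrices

δ-refl : ∀ {n} (i : Fin n) → δ i i ≡ 1ℚ
δ-refl zero    = refl
δ-refl (suc i) = δ-refl i

δ≢0⇒≡ : ∀ {n} (i j : Fin n) → δ i j ≢ 0ℚ → i ≡ j
δ≢0⇒≡ i j δ≢0 with i Fin.≟ j
... | yes i≡j = i≡j
... | no  _   = contradiction refl δ≢0

δ≢𝟎 : ∀ {n} (i : Fin n) → ¬ (∀ j → δ i j ≡ 0ℚ)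
δ≢𝟎 i δ≗0 = ℚ.1≢0 (trans (sym (δ-refl i)) (δ≗0 i))

sum≢0⇒∃ : ∀ {n} (f : Vector ℚ n) → sum f ≢ 0ℚ → ∃[ i ] f i ≢ 0ℚ
sum≢0⇒∃ f Σf≢0 with Fin.any? (λ i → ¬? (f i ℚ.≟ 0ℚ))
... | yes found = found
... | no  none  = contradiction
  (Detℚ.sum-zero λ i → decidable-stable (f i ℚ.≟ 0ℚ) λ fᵢ≢0 → none (i , fᵢ≢0)) Σf≢0

⟨⟩-congʳ : ∀ {n} (x : Vector ℚ n) {y z} → y ≗ z → ⟨ x , y ⟩ ≡ ⟨ x , z ⟩
⟨⟩-congʳ x y≗z = sum-cong-≗ λ i → cong (x i ℚ.*_) (y≗z i)

⟨⟩-linearʳ : ∀ {n} (x : Vector ℚ n) s y z → ⟨ x , (λ i → s ℚ.* y i ℚ.+ z i) ⟩ ≡ s ℚ.* ⟨ x , y ⟩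
  ℚ.+ ⟨ x , z ⟩
⟨⟩-linearʳ x s y z = trans
  (sum-cong-≗ λ i → solve 4 (λ x s y z → (x :* (s :* y :+ z)) := (s :* (x :* y) :+ x :* z)) refl
    (x i) s (y i) (z i))
  (sum-linear s (λ i → x i ℚ.* y i) (λ i → x i ℚ.* z i))

⟨⟩-comm : ∀ {n} (x y : Vector ℚ n) → ⟨ x , y ⟩ ≡ ⟨ y , x ⟩
⟨⟩-comm x y = sum-cong-≗ λ i → ℚ.*-comm (x i) (y i)

⟨⟩-linearˡ : ∀ {n} (x : Vector ℚ n) s y z → ⟨ (λ i → s ℚ.* y i ℚ.+ z i) , x ⟩ ≡ s ℚ.* ⟨ y , x ⟩
  ℚ.+ ⟨ z , x ⟩
⟨⟩-linearˡ x s y z = begin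
  ⟨ (λ i → s ℚ.* y i ℚ.+ z i) , x ⟩   ≡⟨ ⟨⟩-comm (λ i → s ℚ.* y i ℚ.+ z i) x ⟩
  ⟨ x , (λ i → s ℚ.* y i ℚ.+ z i) ⟩   ≡⟨ ⟨⟩-linearʳ x s y z ⟩
  s ℚ.* ⟨ x , y ⟩ ℚ.+ ⟨ x , z ⟩       ≡⟨ cong₂ (λ u v → s ℚ.* u ℚ.+ v) (⟨⟩-comm x y) (⟨⟩-comm x z) ⟩
  s ℚ.* ⟨ y , x ⟩ ℚ.+ ⟨ z , x ⟩       ∎

⟨⟩-zeroʳ : ∀ {n} (x : Vector ℚ n) {y} → (∀ i → y i ≡ 0ℚ) → ⟨ x , y ⟩ ≡ 0ℚ
⟨⟩-zeroʳ x y≗0 = Detℚ.sum-zero λ i → trans (cong (x i ℚ.*_) (y≗0 i)) (ℚ.*-zeroʳ (x i))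

-- Moments determine the characteristic polynomial

module _ {n : ℕ} (A B : Matrix n) where

  private
    module A = Krylov A
    module B = Krylov B

  moments : ∀ x y x′ y′ → (∀ k → ⟨ x , A.pow k y ⟩ ≡ ⟨ x′ , B.pow k y′ ⟩) →
    ∀ f → ⟨ x , A.act f y ⟩ ≡ ⟨ x′ , B.act f y′ ⟩
  moments x y x′ y′ eq []      = trans (⟨⟩-zeroʳ x λ _ → refl) (sym (⟨⟩-zeroʳ x′ λ _ → refl))
  moments x y x′ y′ eq (a ∷ f) = begin
    ⟨ x , A.act (a ∷ f) y ⟩                           ≡⟨ ⟨⟩-linearʳ x a y (A.act f (A.A· y)) ⟩
    a ℚ.* ⟨ x , y ⟩ ℚ.+ ⟨ x , A.act f (A.A· y) ⟩
      ≡⟨ cong₂ (λ u v → a ℚ.* u ℚ.+ v) (eq 0) (moments x (A.A· y) x′ (B.A· y′) (eq ∘ suc) f) ⟩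
    a ℚ.* ⟨ x′ , y′ ⟩ ℚ.+ ⟨ x′ , B.act f (B.A· y′) ⟩  ≡⟨ ⟨⟩-linearʳ x′ a y′ (B.act f (B.A· y′)) ⟨
    ⟨ x′ , B.act (a ∷ f) y′ ⟩                         ∎

  -- By Cayley–Hamilton for B, x is orthogonal to the A-orbit of P_B(A)y,
  -- which therefore vanishes; so P_B − P_A annihilates y, and its degree
  -- is less than n.

  moments⇒charPoly : IrreducibleOverℚ (det ℚ[z] n (zI- A)) →
    ∀ x y x′ y′ → ¬ (∀ i → x i ≡ 0ℚ) → ¬ (∀ i → y i ≡ 0ℚ) →
    (∀ k → ⟨ x , A.pow k y ⟩ ≡ ⟨ x′ , B.pow k y′ ⟩) →
    det ℚ[z] n (zI- A) ≈ₚ det ℚ[z] n (zI- B)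
  moments⇒charPoly irr x y x′ y′ x≢0 y≢0 eq k = begin
    coeff P k
      ≡⟨ solve 2 (λ p q → p := (q :+ :- (q :+ :- p))) refl (coeff P k) (coeff Q k) ⟩
    coeff Q k ℚ.+ ℚ.- (coeff Q k ℚ.+ ℚ.- coeff P k)
                                                  ≡⟨ cong (λ d → coeff Q k ℚ.+ ℚ.- d)
                                                       (trans (sym (coeff-D k)) (A.independent irr D
                                                         deg-D y y≢0 Dy≗0 k)) ⟩
    coeff Q k ℚ.+ 0ℚ                              ≡⟨ ℚ.+-identityʳ _ ⟩
    coeff Q k                                     ∎
    where
    P Q D : Poly
    P = det ℚ[z] n (zI- A)
    Q = det ℚ[z] n (zI- B)
    D = Q +ₚ (-ₚ P)
    coeff-D : ∀ k → coeff D k ≡ coeff Q k ℚ.+ ℚ.- coeff P k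
    coeff-D k = trans (coeff-+ Q (-ₚ P) k) (cong (coeff Q k ℚ.+_) (coeff-neg P k))
    deg-D : Deg< D n
    deg-D k n≤k with ℕ.m≤n⇒m<n∨m≡n n≤k
    ... | inj₁ n<k  = trans (coeff-D k)
      (cong₂ (λ u v → u ℚ.+ ℚ.- v) (charPoly-degree B k n<k) (charPoly-degree A k n<k))
    -- At index `n` the two leading coefficients 1 cancel.
    ... | inj₂ refl = trans (coeff-D k)
      (cong₂ (λ u v → u ℚ.+ ℚ.- v) (charPoly-monic B) (charPoly-monic A))
    Qy : Vector ℚ n
    Qy = A.act Q y
    x⊥Qy : ∀ f → ⟨ x , A.act f Qy ⟩ ≡ 0ℚ
    x⊥Qy f = begin
      ⟨ x , A.act f Qy ⟩                ≡⟨ ⟨⟩-congʳ x (A.act-* f Q y) ⟨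
      ⟨ x , A.act (f *ₚ Q) y ⟩          ≡⟨ moments x y x′ y′ eq (f *ₚ Q) ⟩
      ⟨ x′ , B.act (f *ₚ Q) y′ ⟩        ≡⟨ ⟨⟩-congʳ x′ (B.act-* f Q y′) ⟩
      ⟨ x′ , B.act f (B.act Q y′) ⟩     ≡⟨ ⟨⟩-zeroʳ x′ (B.act-zero f (B.cayley-hamilton y′)) ⟩
      0ℚ                                ∎
    Qy≗0 : ∀ i → Qy i ≡ 0ℚ
    -- A nonzero `Qy` would be a cyclic vector with orbit orthogonal to x, forcing x = 0.
    Qy≗0 i = decidable-stable (Qy i ℚ.≟ 0ℚ) λ Qyᵢ≢0 →
      x≢0 (A.nondegenerate irr x Qy (λ Qy≗0 → Qyᵢ≢0 (Qy≗0 i)) x⊥Qy)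
    Dy≗0 : ∀ i → A.act D y i ≡ 0ℚ
    Dy≗0 i = begin
      A.act D y i                           ≡⟨ A.act-+ Q (-ₚ P) y i ⟩
      Qy i ℚ.+ A.act (-ₚ P) y i
        ≡⟨ cong₂ ℚ._+_ (Qy≗0 i) (trans (A.act-neg P y i) (cong (ℚ.-_) (A.cayley-hamilton y i))) ⟩
      0ℚ                                    ∎

module _ {n : ℕ} (A : Matrix n) (symmetric : ∀ i j → A i j ≡ A j i) where

  open Krylov A

  ·-self-adjoint : ∀ x y → ⟨ x , A· y ⟩ ≡ ⟨ A· x , y ⟩
  ·-self-adjoint x y = begin
    ∑[ i < n ] (x i ℚ.* (∑[ j < n ] (A i j ℚ.* y j)))
      ≡⟨ sum-cong-≗ (λ i → *-distribˡ-sum (x i) (λ j → A i j ℚ.* y j)) ⟩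
    ∑[ i < n ] ∑[ j < n ] (x i ℚ.* (A i j ℚ.* y j))
      ≡⟨ ∑-comm (λ i j → x i ℚ.* (A i j ℚ.* y j)) ⟩
    ∑[ j < n ] ∑[ i < n ] (x i ℚ.* (A i j ℚ.* y j))     ≡⟨ sum-cong-≗ (λ j → sum-cong-≗ λ i → trans
                                                             (cong (λ a → x i ℚ.* (a ℚ.* y j))
                                                               (symmetric i j))
                                                             (solve 3 (λ x a y → (x :* (a :* y)) :=
                                                               (a :* x :* y)) refl (x i) (A j i)
                                                                 (y j))) ⟩
    ∑[ j < n ] ∑[ i < n ] (A j i ℚ.* x i ℚ.* y j)
      ≡⟨ sum-cong-≗ (λ j → *-distribʳ-sum (y j) (λ i → A j i ℚ.* x i)) ⟨
    ∑[ j < n ] ((∑[ i < n ] (A j i ℚ.* x i)) ℚ.* y j)   ∎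

  act-self-adjoint : ∀ f x y → ⟨ x , act f y ⟩ ≡ ⟨ act f x , y ⟩
  act-self-adjoint []      x y = trans (⟨⟩-zeroʳ x λ _ → refl)
    (trans (sym (⟨⟩-zeroʳ y λ _ → refl)) (⟨⟩-comm y (act [] x)))
  act-self-adjoint (a ∷ f) x y = begin
    ⟨ x , act (a ∷ f) y ⟩                        ≡⟨ ⟨⟩-linearʳ x a y (act f (A· y)) ⟩
    a ℚ.* ⟨ x , y ⟩ ℚ.+ ⟨ x , act f (A· y) ⟩     ≡⟨ cong (a ℚ.* ⟨ x , y ⟩ ℚ.+_) (begin
      ⟨ x , act f (A· y) ⟩     ≡⟨ act-self-adjoint f x (A· y) ⟩
      ⟨ act f x , A· y ⟩       ≡⟨ ·-self-adjoint (act f x) y ⟩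
      ⟨ A· act f x , y ⟩       ≡⟨ ⟨⟩-comm (A· act f x) y ⟩
      ⟨ y , A· act f x ⟩       ≡⟨ ⟨⟩-congʳ y (act-· f x) ⟨
      ⟨ y , act f (A· x) ⟩     ≡⟨ ⟨⟩-comm y (act f (A· x)) ⟩
      ⟨ act f (A· x) , y ⟩     ∎) ⟩
    a ℚ.* ⟨ x , y ⟩ ℚ.+ ⟨ act f (A· x) , y ⟩     ≡⟨ ⟨⟩-linearˡ y a x (act f (A· x)) ⟨
    ⟨ act (a ∷ f) x , y ⟩                        ∎

module _ {n : ℕ} (G : Graph n) where

  private
    A : Matrix n
    A = adjacencyMatrix G

  open Krylov A

  adjacencyMatrix-symmetric : ∀ i j → A i j ≡ A j i
  adjacencyMatrix-symmetric i j = cong (if_then 1ℚ else 0ℚ) (symmetric G i j)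

  A≢0⇒Adj : ∀ i j → A i j ≢ 0ℚ → Adj G i j
  A≢0⇒Adj i j A≢0 with adj G i j
  ... | true  = tt
  ... | false = contradiction refl A≢0

  -- Entry u of Aᵏx collects the entries of x at the ends of walks of length k from u, so a nonzero
  -- value needs a walk into the support of x.
  act≢0⇒reachable : ∀ f x u → act f x u ≢ 0ℚ → ∃[ w ] (x w ≢ 0ℚ × Star (Adj G) u w)
  act≢0⇒reachable []      x u 0≢0 = contradiction refl 0≢0
  act≢0⇒reachable (a ∷ f) x u act≢0 with x u ℚ.≟ 0ℚ
  ... | no  xᵤ≢0 = u , xᵤ≢0 , Star.ε
  ... | yes xᵤ≡0 with act≢0⇒reachable f (A· x) u
    (λ act≡0 → act≢0 (cong₂ ℚ._+_ (trans (cong (a ℚ.*_) xᵤ≡0) (ℚ.*-zeroʳ a)) act≡0))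
  ...   | w , Ax≢0 , u⟶w with sum≢0⇒∃ (λ j → A w j ℚ.* x j) Ax≢0
  ...     | t , Axₜ≢0 = t
    , (λ xₜ≡0 → Axₜ≢0 (trans (cong (A w t ℚ.*_) xₜ≡0) (ℚ.*-zeroʳ (A w t))))
    , u⟶w ◅◅ (A≢0⇒Adj w t (λ A≡0 → Axₜ≢0 (trans (cong (ℚ._* x t) A≡0) (ℚ.*-zeroˡ (x t)))) ◅ Star.ε)

  -- Cyclicity of e_v gives c e_u + g(A)e_v = 0 with c ≠ 0. Entry u of g(A)e_v is therefore nonzero,
  -- and the support of e_v is v alone.
  irreducible⇒connected : IrreducibleCharPoly G → Connected G
  irreducible⇒connected irr u v with cyclic irr (δ v) (δ≢𝟎 v) (δ u)
  ... | c , g , c≢0 , eq with act≢0⇒reachable g (δ v) u (λ act≡0 → c≢0 (begin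
    c                                     ≡⟨ solve 1 (λ c → c := (c :* con 1ℚ :+ con 0ℚ)) refl c ⟩
    c ℚ.* 1ℚ ℚ.+ 0ℚ                       ≡⟨ cong₂ (λ d e → c ℚ.* d ℚ.+ e) (δ-refl u) act≡0 ⟨
    c ℚ.* δ u u ℚ.+ act g (δ v) u         ≡⟨ eq u ⟩
    0ℚ                                    ∎))
  ... | w , δ≢0 , u⟶w with δ≢0⇒≡ v w δ≢0
  ... | refl = u⟶w

  pow-cong : ∀ k {x y} → x ≗ y → pow k x ≗ pow k y
  pow-cong zero    x≗y = x≗y
  pow-cong (suc k) x≗y = pow-cong k (·-cong x≗y)

  -- The explicit scalars -1 and 1 give both vectors the shape `s ℚ.* y i ℚ.+ z i` of the linearity
  -- lemmas.
  _-δ_ _+δ_ : Fin n → Fin n → Vector ℚ n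
  (v -δ u) i = (ℚ.- 1ℚ) ℚ.* δ u i ℚ.+ δ v i
  (v +δ u) i = 1ℚ ℚ.* δ u i ℚ.+ δ v i

  -δ≗0⇒≡ : ∀ v u → (∀ i → (v -δ u) i ≡ 0ℚ) → u ≡ v
  -δ≗0⇒≡ v u eq = δ≢0⇒≡ u v λ δ≡0 → ℚ.1≢0 (begin
    1ℚ                                 ≡⟨ cong₂ (λ d e → (ℚ.- 1ℚ) ℚ.* d ℚ.+ e) δ≡0 (δ-refl v) ⟨
    (ℚ.- 1ℚ) ℚ.* δ u v ℚ.+ δ v v       ≡⟨ eq v ⟩
    0ℚ                                 ∎)

  +δ≢0 : ∀ v u → ¬ (∀ i → (v +δ u) i ≡ 0ℚ)
  -- Entry `v` is 2 or 1, according to whether u equals v.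
  +δ≢0 v u eq with u Fin.≟ v | trans (sym (cong (λ e → 1ℚ ℚ.* δ u v ℚ.+ e) (δ-refl v))) (eq v)
  ... | yes _ | ()
  ... | no  _ | ()

  same-walks⇒≡ : IrreducibleCharPoly G → ∀ v u →
    (∀ k → pow k (λ _ → 1ℚ) v ≡ pow k (λ _ → 1ℚ) u) → u ≡ v
  same-walks⇒≡ irr v u eq = -δ≗0⇒≡ v u
    (nondegenerate irr (v -δ u) 𝟏 (λ 𝟏≗0 → ℚ.1≢0 (𝟏≗0 v)) λ f → begin
    ⟨ v -δ u , act f 𝟏 ⟩
      ≡⟨ ⟨⟩-linearˡ (act f 𝟏) (ℚ.- 1ℚ) (δ u) (δ v) ⟩
    (ℚ.- 1ℚ) ℚ.* ⟨ δ u , act f 𝟏 ⟩ ℚ.+ ⟨ δ v , act f 𝟏 ⟩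
      ≡⟨ cong ((ℚ.- 1ℚ) ℚ.* ⟨ δ u , act f 𝟏 ⟩ ℚ.+_) (moments A A (δ v) 𝟏 (δ u) 𝟏 eq′ f) ⟩
    (ℚ.- 1ℚ) ℚ.* ⟨ δ u , act f 𝟏 ⟩ ℚ.+ ⟨ δ u , act f 𝟏 ⟩
      ≡⟨ solve 1 (λ a → (con (ℚ.- 1ℚ) :* a :+ a) := con 0ℚ) refl ⟨ δ u , act f 𝟏 ⟩ ⟩
    0ℚ                                                      ∎)
    where
    𝟏 : Vector ℚ n
    𝟏 _ = 1ℚ
    eq′ : ∀ k → ⟨ δ v , pow k 𝟏 ⟩ ≡ ⟨ δ u , pow k 𝟏 ⟩
    eq′ k = trans (sum-δˡ (pow k 𝟏) v) (trans (eq k) (sym (sum-δˡ (pow k 𝟏) u)))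

  -- Since A is symmetric, e_v − e_u is orthogonal to the A-orbit of
  -- e_v + e_u.

  same-closed-walks⇒≡ : IrreducibleCharPoly G → ∀ v u →
    (∀ k → pow k (δ v) v ≡ pow k (δ u) u) → u ≡ v
  same-closed-walks⇒≡ irr v u eq = -δ≗0⇒≡ v u
    (nondegenerate irr (v -δ u) (v +δ u) (+δ≢0 v u) λ f → begin
    ⟨ v -δ u , act f (v +δ u) ⟩
      ≡⟨ ⟨⟩-linearˡ (act f (v +δ u)) (ℚ.- 1ℚ) (δ u) (δ v) ⟩
    (ℚ.- 1ℚ) ℚ.* ⟨ δ u , act f (v +δ u) ⟩ ℚ.+ ⟨ δ v , act f (v +δ u) ⟩
      ≡⟨ cong₂ (λ a b → (ℚ.- 1ℚ) ℚ.* a ℚ.+ b) (expand f u) (expand f v) ⟩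
    (ℚ.- 1ℚ) ℚ.* (1ℚ ℚ.* ⟨ δ u , act f (δ u) ⟩ ℚ.+ ⟨ δ u , act f (δ v) ⟩) ℚ.+
      (1ℚ ℚ.* ⟨ δ v , act f (δ u) ⟩ ℚ.+ ⟨ δ v , act f (δ v) ⟩)
      ≡⟨ cong₂ (λ a b → (ℚ.- 1ℚ) ℚ.* (1ℚ ℚ.* ⟨ δ u , act f (δ u) ⟩ ℚ.+ ⟨ δ u , act f (δ v) ⟩) ℚ.+
           (1ℚ ℚ.* a ℚ.+ b))
           (trans (act-self-adjoint A adjacencyMatrix-symmetric f (δ v) (δ u))
             (⟨⟩-comm (act f (δ v)) (δ u)))
           (moments A A (δ v) (δ v) (δ u) (δ u) eq′ f) ⟩
    (ℚ.- 1ℚ) ℚ.* (1ℚ ℚ.* ⟨ δ u , act f (δ u) ⟩ ℚ.+ ⟨ δ u , act f (δ v) ⟩) ℚ.+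
      (1ℚ ℚ.* ⟨ δ u , act f (δ v) ⟩ ℚ.+ ⟨ δ u , act f (δ u) ⟩)
      ≡⟨ solve 2 (λ a b → (con (ℚ.- 1ℚ) :* (con 1ℚ :* a :+ b) :+ (con 1ℚ :* b :+ a)) := con 0ℚ)
           refl ⟨ δ u , act f (δ u) ⟩ ⟨ δ u , act f (δ v) ⟩ ⟩
    0ℚ ∎)
    where
    eq′ : ∀ k → ⟨ δ v , pow k (δ v) ⟩ ≡ ⟨ δ u , pow k (δ u) ⟩
    eq′ k = trans (sum-δˡ (pow k (δ v)) v) (trans (eq k) (sym (sum-δˡ (pow k (δ u)) u)))
    expand : ∀ f w → ⟨ δ w , act f (v +δ u) ⟩ ≡ 1ℚ ℚ.* ⟨ δ w , act f (δ u) ⟩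
      ℚ.+ ⟨ δ w , act f (δ v) ⟩
    expand f w = trans (⟨⟩-congʳ (δ w) (act-linear f 1ℚ (δ u) (δ v)))
      (⟨⟩-linearʳ (δ w) 1ℚ (act f (δ u)) (act f (δ v)))

-- Transport along an isomorphism

module _ {n : ℕ} {G H : Graph n} (φ : G ≅ H) where

  private
    module G = Krylov (adjacencyMatrix G)
    module H = Krylov (adjacencyMatrix H)

  open _≅_ φ

  ·-map : ∀ y → (H.A· y) ∘ map ≗ G.A· (y ∘ map)
  ·-map y i = begin
    sum (λ j → adjacencyMatrix H (map i) j ℚ.* y j)
      ≡⟨ sum-permute (λ j → adjacencyMatrix H (map i) j ℚ.* y j) bijection ⟩
    sum (λ j → adjacencyMatrix H (map i) (map j) ℚ.* y (map j))
      ≡⟨ sum-cong-≗ (λ j → cong (λ b → (if b then 1ℚ else 0ℚ) ℚ.* y (map j)) (preserves i j)) ⟩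
    sum (λ j → adjacencyMatrix G i j ℚ.* y (map j))              ∎

  pow-map : ∀ k y → H.pow k y ∘ map ≗ G.pow k (y ∘ map)
  pow-map zero    y i = refl
  pow-map (suc k) y i = trans (pow-map k (H.A· y) i) (pow-cong G k (·-map y) i)

  δ-map : ∀ u → δ (map u) ∘ map ≗ δ u
  δ-map u i with map u Fin.≟ map i | u Fin.≟ i
  ... | yes _  | yes _    = refl
  ... | no  _  | no _     = refl
  ... | yes eq | no u≢i   = contradiction
    (trans (sym (Inverse.strictlyInverseʳ bijection u))
      (trans (cong (Inverse.from bijection) eq) (Inverse.strictlyInverseʳ bijection i))) u≢i
  ... | no neq | yes refl = contradiction refl neq

-- Counting walks

open Mult ℚ.+-0-monoid using () renaming (_×_ to _•_; ×-homo-+ to •-homo-+)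

-- Counts enter ℚ as repeated sums of 1, so concatenation becomes addition.
# : ∀ {a} {A : Set a} → List A → ℚ
# xs = length xs • 1ℚ

#-++ : ∀ {a} {A : Set a} (xs ys : List A) → # (xs ++ ys) ≡ # xs ℚ.+ # ys
#-++ xs ys = trans (cong (_• 1ℚ) (List.length-++ xs)) (•-homo-+ 1ℚ (length xs) (length ys))

length-filter-map : ∀ {a b p} {A : Set a} {B : Set b} {P : Pred B p} (P? : Decidable P)
  (f : A → B) xs →
  length (filter P? (List.map f xs)) ≡ length (filter (P? ∘ f) xs)
length-filter-map P? f []       = refl
length-filter-map P? f (x ∷ xs) with does (P? (f x))
... | true  = cong suc (length-filter-map P? f xs)
... | false = length-filter-map P? f xs

#-filter-cartesianProduct : ∀ {a b c p} {A : Set a} {B : Set b} {C : Set c} {P : Pred C p}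
  (P? : Decidable P)
  (f : A → B → C) {m} (g : Fin m → A) ys →
  # (filter P? (cartesianProductWith f (List.tabulate g) ys)) ≡ ∑[ i < m ] #
    (filter (P? ∘ f (g i)) ys)
#-filter-cartesianProduct P? f {zero}  g ys = refl
#-filter-cartesianProduct P? f {suc m} g ys = begin
  # (filter P? (List.map (f (g zero)) ys ++ rest))
    ≡⟨ cong # (List.filter-++ P? (List.map (f (g zero)) ys) rest) ⟩
  # (filter P? (List.map (f (g zero)) ys) ++ filter P? rest)
    ≡⟨ #-++ (filter P? (List.map (f (g zero)) ys)) (filter P? rest) ⟩
  # (filter P? (List.map (f (g zero)) ys)) ℚ.+ # (filter P? rest)
    ≡⟨ cong₂ ℚ._+_ (cong (_• 1ℚ) (length-filter-map P? (f (g zero)) ys))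
         (#-filter-cartesianProduct P? f (g ∘ suc) ys) ⟩
  # (filter (P? ∘ f (g zero)) ys) ℚ.+ ∑[ i < m ] # (filter (P? ∘ f (g (suc i))) ys) ∎
  where rest = cartesianProductWith f (List.tabulate (g ∘ suc)) ys

#-filter-none : ∀ {a p} {A : Set a} {P : Pred A p} (P? : Decidable P) → (∀ x → ¬ P x) → ∀ xs → #
  (filter P? xs) ≡ 0ℚ
#-filter-none P? ¬P xs = cong # (List.filter-none P? (universal ¬P xs))

Adj⇒A≡1 : ∀ {n} (G : Graph n) i j → Adj G i j → adjacencyMatrix G i j ≡ 1ℚ
Adj⇒A≡1 G i j i~j with true ← adj G i j = refl

module _ {n : ℕ} (G : Graph n) where

  private
    A : Matrix n
    A = adjacencyMatrix G

  open Krylov A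

  -- `pow` applies its next factor `A` innermost, whereas removing the first step of a walk strips
  -- the outermost factor.
  pow-· : ∀ k x → pow k (A· x) ≗ A· pow k x
  pow-· zero    x i = refl
  pow-· (suc k) x i = pow-· k (A· x) i

  -- `Q` constrains the last vertex. One count thus serves both sequences: `Q` is trivial for walks
  -- and equality with the start for closed walks.
  module _ {p} {Q : Pred (Fin n) p} (Q? : Decidable Q) where

    𝟏[_] : Vector ℚ n
    𝟏[_] w = if does (Q? w) then 1ℚ else 0ℚ

    -- The start `v` stays outside the vector, so that the induction on length may replace it by the
    -- second vertex.
    extends? : ∀ {k} v → Decidable
      (λ (vs : Vec (Fin n) k) → Linked (Adj G) (v ∷ vs) × Q (Vec.last (v ∷ vs)))
    extends? v vs = linked? (λ i j → T? (adj G i j)) (v ∷ vs) ×-dec Q? (Vec.last (v ∷ vs))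

    #-extensions : ∀ k v → # (filter (extends? v) (allVecs n k)) ≡ pow k 𝟏[_] v
    #-extensions zero    v with Q? v
    ... | yes _ = refl
    ... | no  _ = refl
    #-extensions (suc k) v = begin
      # (filter (extends? v) (allVecs n (suc k)))
        ≡⟨ #-filter-cartesianProduct (extends? v) _∷_ id (allVecs n k) ⟩
      ∑[ w < n ] # (filter (extends? v ∘ (w ∷_)) (allVecs n k))
        ≡⟨ sum-cong-≗ step ⟩
      ∑[ w < n ] (A v w ℚ.* pow k 𝟏[_] w)
        ≡⟨ pow-· k 𝟏[_] v ⟨
      pow k (A· 𝟏[_]) v ∎
      where
      step : ∀ w → # (filter (extends? v ∘ (w ∷_)) (allVecs n k)) ≡ A v w ℚ.* pow k 𝟏[_] w
      step w = by-adjacency (T? (adj G v w))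
        where
        by-adjacency : Dec (Adj G v w) → #
          (filter (extends? v ∘ (w ∷_)) (allVecs n k)) ≡ A v w ℚ.* pow k 𝟏[_] w
        by-adjacency (yes v~w) = begin
          # (filter (extends? v ∘ (w ∷_)) (allVecs n k))
            ≡⟨ cong # (List.filter-≐ (extends? v ∘ (w ∷_)) (extends? w)
                 ((λ (vw , q) → Linked.tail vw , q) , (λ (ws , q) → v~w ∷ ws , q)) (allVecs n k)) ⟩
          # (filter (extends? w) (allVecs n k))
            ≡⟨ #-extensions k w ⟩
          pow k 𝟏[_] w
            ≡⟨ ℚ.*-identityˡ _ ⟨
          1ℚ ℚ.* pow k 𝟏[_] w
            ≡⟨ cong (ℚ._* pow k 𝟏[_] w) (Adj⇒A≡1 G v w v~w) ⟨
          A v w ℚ.* pow k 𝟏[_] w ∎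
        by-adjacency (no v≁w) = begin
          # (filter (extends? v ∘ (w ∷_)) (allVecs n k))
            ≡⟨ #-filter-none (extends? v ∘ (w ∷_)) (λ vs (vw , _) → v≁w (Linked.head vw))
                 (allVecs n k) ⟩
          0ℚ
            ≡⟨ ℚ.*-zeroˡ (pow k 𝟏[_] w) ⟨
          0ℚ ℚ.* pow k 𝟏[_] w
            ≡⟨ cong (ℚ._* pow k 𝟏[_] w) (decidable-stable (A v w ℚ.≟ 0ℚ) (v≁w ∘ A≢0⇒Adj G v w)) ⟨
          A v w ℚ.* pow k 𝟏[_] w ∎

    #-walks : ∀ k v {r} {R : Pred (Vec (Fin n) (suc k)) r} (R? : Decidable R) →
      (∀ i vs → R (i ∷ vs) → i ≡ v × Linked (Adj G) (i ∷ vs) × Q (Vec.last (i ∷ vs))) →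
      (∀ vs → Linked (Adj G) (v ∷ vs) × Q (Vec.last (v ∷ vs)) → R (v ∷ vs)) →
      # (filter R? (allVecs n (suc k))) ≡ pow k 𝟏[_] v
    #-walks k v R? to from = begin
      # (filter R? (allVecs n (suc k)))
        ≡⟨ #-filter-cartesianProduct R? _∷_ id (allVecs n k) ⟩
      ∑[ i < n ] # (filter (R? ∘ (i ∷_)) (allVecs n k))
        -- `allVecs` also runs over the first vertex; only the choice `v` contributes, hence the
        -- factor `δ v i`.
        ≡⟨ sum-cong-≗ start ⟩
      ∑[ i < n ] (δ v i ℚ.* pow k 𝟏[_] i)
        ≡⟨ sum-δˡ (pow k 𝟏[_]) v ⟩
      pow k 𝟏[_] v ∎
      where
      start : ∀ i → # (filter (R? ∘ (i ∷_)) (allVecs n k)) ≡ δ v i ℚ.* pow k 𝟏[_] i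
      start i with v Fin.≟ i
      ... | yes refl = begin
        # (filter (R? ∘ (v ∷_)) (allVecs n k))
          ≡⟨ cong # (List.filter-≐ (R? ∘ (v ∷_)) (extends? v)
               ((λ {vs} r → proj₂ (to v vs r)) , (λ {vs} → from vs)) (allVecs n k)) ⟩
        # (filter (extends? v) (allVecs n k))
          ≡⟨ #-extensions k v ⟩
        pow k 𝟏[_] v
          ≡⟨ ℚ.*-identityˡ _ ⟨
        1ℚ ℚ.* pow k 𝟏[_] v ∎
      ... | no v≢i = trans
        (#-filter-none (R? ∘ (i ∷_)) (λ vs r → v≢i (sym (proj₁ (to i vs r)))) (allVecs n k))
        (sym (ℚ.*-zeroˡ (pow k 𝟏[_] i)))

  -- With the trivial end condition `𝟏[_]` computes to the all-ones vector; with equality to `v`, as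
  -- for closed walks, it computes to `δ v`.
  walkCount≡pow : ∀ k v → walkCount G v k • 1ℚ ≡ pow k (λ _ → 1ℚ) v
  walkCount≡pow k v = #-walks (λ _ → yes tt) k v (isWalkFrom? G v)
    (λ i vs (i≡v , linked) → i≡v , linked , tt) (λ vs (linked , _) → refl , linked)

  closedWalkCount≡pow : ∀ k v → closedWalkCount G v k • 1ℚ ≡ pow k (δ v) v
  closedWalkCount≡pow k v = #-walks (v Fin.≟_) k v (isClosedWalkFrom? G v)
    (λ { i vs ((refl , linked) , closed) → refl , linked , closed })
      (λ vs (linked , closed) → (refl , linked) , closed)

-- Decisive vertices and the passage to random graphs

decisive : ∀ {n} {G : Graph n} → DeterminedBySpectrum G → IrreducibleCharPoly G → ∀ v → Decisive G v
decisive {n} {G} ds irr v = (connected , λ H _ u → W-decisive H u) ,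
  (connected , λ H _ u → R-decisive H u)
  where
  module G = Krylov (adjacencyMatrix G)
  𝟏 : Vector ℚ n
  𝟏 _ = 1ℚ
  connected : Connected G
  connected = irreducible⇒connected G irr

  W-decisive : ∀ H u → W G v ≗ W H u → RootedIso G v H u
  W-decisive H u W≗ = φ , trans (cong map (sym from-u≡v)) (Inverse.strictlyInverseˡ bijection u)
    where
    module H = Krylov (adjacencyMatrix H)
    walks : ∀ k → G.pow k 𝟏 v ≡ H.pow k 𝟏 u
    -- The sequence begins at length 1; the moment of length 0 is 1 on both sides.
    walks zero    = refl
    walks (suc k) = trans (sym (walkCount≡pow G (suc k) v))
      (trans (cong (_• 1ℚ) (W≗ k)) (walkCount≡pow H (suc k) u))
    φ : G ≅ H
    φ = ds H (moments⇒charPoly (adjacencyMatrix G) (adjacencyMatrix H) irr (δ v) 𝟏 (δ u) 𝟏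
      (δ≢𝟎 v) (λ 𝟏≗0 → ℚ.1≢0 (𝟏≗0 v))
      (λ k → trans (sum-δˡ (G.pow k 𝟏) v) (trans (walks k) (sym (sum-δˡ (H.pow k 𝟏) u)))))
    open _≅_ φ
    -- The isomorphism obtained from the spectrum knows nothing of the roots. Walk counts are
    -- invariant under it, so `u` is pulled back to `G` and compared with `v` there.
    from-u≡v : Inverse.from bijection u ≡ v
    from-u≡v = same-walks⇒≡ G irr v (Inverse.from bijection u) λ k → begin
      G.pow k 𝟏 v                                ≡⟨ walks k ⟩
      H.pow k 𝟏 u
        ≡⟨ cong (H.pow k 𝟏) (Inverse.strictlyInverseˡ bijection u) ⟨
      H.pow k 𝟏 (map (Inverse.from bijection u)) ≡⟨ pow-map φ k 𝟏 (Inverse.from bijection u) ⟩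
      G.pow k 𝟏 (Inverse.from bijection u)       ∎

  R-decisive : ∀ H u → R G v ≗ R H u → RootedIso G v H u
  R-decisive H u R≗ = φ , trans (cong map (sym from-u≡v)) (Inverse.strictlyInverseˡ bijection u)
    where
    module H = Krylov (adjacencyMatrix H)
    walks : ∀ k → G.pow k (δ v) v ≡ H.pow k (δ u) u
    -- Length 0 is again supplied by hand: both diagonal entries of the identity are 1.
    walks zero    = trans (δ-refl v) (sym (δ-refl u))
    walks (suc k) = trans (sym (closedWalkCount≡pow G (suc k) v))
      (trans (cong (_• 1ℚ) (R≗ k)) (closedWalkCount≡pow H (suc k) u))
    φ : G ≅ H
    φ = ds H (moments⇒charPoly (adjacencyMatrix G) (adjacencyMatrix H) irr (δ v) (δ v) (δ u) (δ u)
      (δ≢𝟎 v) (δ≢𝟎 v)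
      (λ k → trans (sum-δˡ (G.pow k (δ v)) v) (trans (walks k) (sym (sum-δˡ (H.pow k (δ u)) u)))))
    open _≅_ φ
    u′ : Fin n
    u′ = Inverse.from bijection u
    -- For closed walks the starting vector moves together with the position, hence `δ-map` besides
    -- `pow-map`.
    from-u≡v : u′ ≡ v
    from-u≡v = same-closed-walks⇒≡ G irr v u′ λ k → begin
      G.pow k (δ v) v                      ≡⟨ walks k ⟩
      H.pow k (δ u) u
        ≡⟨ cong (λ u → H.pow k (δ u) u) (Inverse.strictlyInverseˡ bijection u) ⟨
      H.pow k (δ (map u′)) (map u′)        ≡⟨ pow-map φ k (δ (map u′)) u′ ⟩
      G.pow k (δ (map u′) ∘ map) u′        ≡⟨ pow-cong G k (δ-map φ u′) u′ ⟩
      G.pow k (δ u′) u′                    ∎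

charPoly-cong : ∀ {n} {G H : Graph n} → G ≐ H → charPoly G ≈ₚ charPoly H
charPoly-cong G≐H = Detₚ.det-cong λ i j k → cong (λ b → coeff
  ((if does (i Fin.≟ j) then indeterminate else []) +ₚ (-ₚ constant (if b then 1ℚ else 0ℚ))) k)
    (G≐H i j)

irreducible-resp-≐ : ∀ {n} {G H : Graph n} → G ≐ H → IrreducibleCharPoly H → IrreducibleCharPoly G
irreducible-resp-≐ {G = G} {H} G≐H (RawSemiringDefinitions.mkIrred H∤1 split) =
  RawSemiringDefinitions.mkIrred
  (λ (h , hG≈1) → H∤1 (h , λ k → trans (*ₚ-congˡ h (λ k → sym (charPoly-cong {G = G} {H} G≐H k)) k)
    (hG≈1 k)))
  (λ {p} {q} G≈pq → split {p} {q} (λ k → trans (sym (charPoly-cong {G = G} {H} G≐H k)) (G≈pq k)))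

corollary3p2 : AsymptoticallyAlmostSurely DeterminedBySpectrum →
    AsymptoticallyAlmostSurely IrreducibleCharPoly →
    AsymptoticallyAlmostSurely (λ G → ∀ v → Decisive G v)
-- Irreducibility takes the place of `Q`, the property moved along `≐`; determination by spectrum
-- holds for the listed graph itself.
corollary3p2 = almost-surely-∧ {DeterminedBySpectrum} {IrreducibleCharPoly}
  {λ G → ∀ v → Decisive G v}
  (λ {_} {G} {H} → irreducible-resp-≐ {G = G} {H}) decisive
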